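{- Let $(U,d)$ be an asymmetric pseudometric space with $|U|=n$, $k$ an integer with $2\le k\le n$, and $R^*>0$ the optimal AMMD value. Then the algorithm $\mathrm{BAC}(U,d,k)$ (described in the context) is a $\frac{1}{6k}$-approximation for AMMD: it returns a set $S\subseteq U$ with $|S|=k$ and $\operatorname{div}(S)\ge \frac{R^*}{6k}$.
   Context: An asymmetric pseudometric space $(U,d)$ is a finite set $U$ with $d:U\times U\to\mathbb{R}_{\ge 0}$ such that $d(u,u)=0$ and $d(u,v)\le d(u,w)+d(w,v)$ for all $u,v,w\in U$ ($d$ need not be symmetric). For $S\subseteq U$, $\operatorname{div}(S)=\min_{u,v\in S,\,u\ne v} d(u,v)$; AMMD asks for $O\subseteq U$, $|O|=k$, maximizing $\operatorname{div}(O)$, with maximum value $R^*$. $d_{\min}(u,v)=\min\{d(u,v),d(v,u)\}$, $d_{\max}(u,v)=\max\{d(u,v),d(v,u)\}$. Cluster$(U,d,R)$ (for $R>0$): initially all points are unmarked; while an unmarked point exists, choose any unmarked point $c$, let $A=\{v \text{ unmarked}: d_{\max}(c,v)<R\}$, mark all points of $A$, and add $c$ to the output set $U'$. Return $U'$. Extract$(W,d,\sigma,k)$ (for $W\subseteq U$, $\sigma>0$): build the digraph $G$ on $W$ with an arc $ij$ ($i\ne j$) iff $d(i,j)<\sigma$. If $G$ contains a directed cycle, let $C$ be a chordless directed cycle of $G$ (no arcs of $G$ between non-consecutive vertices of the cycle). Let $G_c$ be the condensation of $G$ (vertices are strongly connected components), $M$ a maximum antichain of $G_c$ (a maximum set of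 pairwise mutually unreachable vertices), and $L$ a path in $G_c$ with $2k-1$ arcs that is a shortest path between its endpoints, or, if none exists, a longest path among shortest paths found in $G_c$; $|C|,|L|$ denote numbers of vertices. If $C$ exists, $|C|\ge 2|M|-1$ and $|C|\ge|L|$, let $I$ be the vertices of $C=(v_1,\dots,v_\ell)$ with odd indices; else if $2|M|-1\ge|L|$, let $I$ consist of one point of $G$ from each component in $M$; else let $I$ consist of one point of $G$ from each component on $L$ with odd index. If $|I|\ge k$, output $k$ points greedily selected from $I$ (repeatedly adding a point of $I$ maximizing the $d_{\min}$-distance to the already selected points); otherwise return nothing. BAC$(U,d,k)$: for every $R\in\{d(i,j)>0: i,j\in U, i\ne j\}$, compute $U'=$ Cluster$(U,d,R)$ and call Extract$(U',d,R/(2k),k)$; return the set with the largest $\operatorname{div}$ among all sets returned by Extract. -}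

module Defs where

open import Algebra.Bundles using (CommutativeRing)
import Algebra.Construct.NaturalChoice.Max as Max
import Algebra.Construct.NaturalChoice.Min as Min
import Algebra.Properties.Semiring.Mult as Mult
open import Data.Empty.Polymorphic using (⊥)
open import Data.Fin.Base using (Fin; toℕ)
open import Data.Fin.Subset using (Subset; _∈_; Empty; ⁅_⁆; _∪_; _─_; ⋃; ∣_∣) renaming (⊤ to full; ⊥ to ∅)
open import Data.List.Base using (List; []; _∷_; [_]; _++_; length; lookup; map; head; last)
import Data.List.Membership.Propositional as List
import Data.List.Membership.Setoid as SetoidMembership
open import Data.List.Relation.Binary.Pointwise using (Pointwise)
open import Data.List.Relation.Unary.All using (All)
open import Data.List.Relation.Unary.AllPairs using (AllPairs)
open import Data.List.Relation.Unary.Linked using (Linked)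
open import Data.List.Relation.Unary.Unique.Propositional using (Unique)
import Data.List.Relation.Unary.Unique.Setoid as SetoidUnique
open import Data.Maybe.Base using (Maybe; just; nothing)
open import Data.Nat.Base as ℕ using (ℕ; _∸_)
open import Data.Product.Base using (∃; ∃₂; _×_)
open import Data.Sum.Base using (_⊎_)
open import Function.Bundles using (_⇔_)
open import Level using (Level; _⊔_)
open import Relation.Binary.Bundles using (DecTotalOrder)
open import Relation.Binary.Construct.Closure.ReflexiveTransitive using (Star)
open import Relation.Binary.Core using (Rel)
import Relation.Binary.Properties.DecTotalOrder as DecTotalOrderProperties
open import Relation.Binary.PropositionalEquality.Core using (_≡_; _≢_)
open import Relation.Binary.Structures using (IsDecTotalOrder)
open import Relation.Nullary.Negation.Core using (¬_)

-- The real numbers enter only as a linearly ordered field, so distances take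
-- values in an arbitrary one.

record OrderedField c ℓ₁ ℓ₂ : Set (Level.suc (c ⊔ ℓ₁ ⊔ ℓ₂)) where
  infix 4 _≤_
  infix 8 _⁻¹
  infixl 7 _/_
  field
    commutativeRing : CommutativeRing c ℓ₁
  open CommutativeRing commutativeRing public
  field
    _≤_             : Rel Carrier ℓ₂
    isDecTotalOrder : IsDecTotalOrder _≈_ _≤_
    +-monoˡ-≤       : ∀ z {x y} → x ≤ y → x + z ≤ y + z
    *-nonNegative   : ∀ {x y} → 0# ≤ x → 0# ≤ y → 0# ≤ x * y
    0≉1             : ¬ 0# ≈ 1#
    -- The value of 0# ⁻¹ is unconstrained.
    _⁻¹             : Carrier → Carrier
    *-inverseʳ      : ∀ x → ¬ x ≈ 0# → x * x ⁻¹ ≈ 1#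

  decTotalOrder : DecTotalOrder c ℓ₁ ℓ₂
  decTotalOrder = record { isDecTotalOrder = isDecTotalOrder }

  open DecTotalOrderProperties decTotalOrder public using (_<_)
  open Max (DecTotalOrder.totalOrder decTotalOrder) public using () renaming (_⊔_ to max)
  open Min (DecTotalOrder.totalOrder decTotalOrder) public using () renaming (_⊓_ to min)

  _/_ : Carrier → Carrier → Carrier
  x / y = x * y ⁻¹

  fromℕ : ℕ → Carrier
  fromℕ m = Mult._×_ semiring m 1#

record Digraph {v} (V : Set v) (p a : Level) : Set (v ⊔ Level.suc (p ⊔ a)) where
  field
    Vertex : V → Set p
    Arc    : V → V → Set a

-- The entries of a list at the indices 1, 3, 5, … , counting from 1.
oddIndexed : ∀ {a} {A : Set a} → List A → List A
oddIndexed []           = []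
oddIndexed (x ∷ [])     = [ x ]
oddIndexed (x ∷ _ ∷ xs) = x ∷ oddIndexed xs

-- Position j follows position i in a cyclic sequence of length ℓ.
CyclicSuc : ∀ {ℓ} → Fin ℓ → Fin ℓ → Set
CyclicSuc {ℓ} i j = ℕ.suc (toℕ i) ≡ toℕ j ⊎ (ℕ.suc (toℕ i) ≡ ℓ × toℕ j ≡ 0)

Consecutive : ∀ {ℓ} → Fin ℓ → Fin ℓ → Set
Consecutive i j = CyclicSuc i j ⊎ CyclicSuc j i

module _ {v p a} {V : Set v} (G : Digraph V p a) where
  open Digraph G

  Reaches : V → V → Set (v ⊔ a)
  Reaches = Star Arc

  IsPath : List V → Set (v ⊔ p ⊔ a)
  IsPath xs = xs ≢ [] × All Vertex xs × Linked Arc xs × Unique xs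

  numArcs : List V → ℕ
  numArcs xs = length xs ∸ 1

  IsShortestPath : List V → Set (v ⊔ p ⊔ a)
  IsShortestPath xs = IsPath xs ×
    (∀ ys → IsPath ys → head ys ≡ head xs → last ys ≡ last xs → numArcs xs ℕ.≤ numArcs ys)

  IsLongestShortestPath : List V → Set (v ⊔ p ⊔ a)
  IsLongestShortestPath xs = IsShortestPath xs ×
    (∀ ys → IsShortestPath ys → numArcs ys ℕ.≤ numArcs xs)

  -- v₁ ∷ … ∷ vₗ ∷ [] is the cycle v₁ → … → vₗ → v₁.
  IsCycle : List V → Set (v ⊔ p ⊔ a)
  IsCycle []       = ⊥
  IsCycle (x ∷ xs) = 2 ℕ.≤ length (x ∷ xs) × All Vertex (x ∷ xs) ×
                     Unique (x ∷ xs) × Linked Arc (x ∷ xs ++ [ x ])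

  IsChordlessCycle : List V → Set (v ⊔ p ⊔ a)
  IsChordlessCycle xs = IsCycle xs ×
    (∀ i j → i ≢ j → ¬ Consecutive i j → ¬ Arc (lookup xs i) (lookup xs j))

  -- Distinctness of the members follows from reflexivity of Reaches.
  IsAntichain : List V → Set (v ⊔ p ⊔ a)
  IsAntichain xs = All Vertex xs × AllPairs (λ x y → ¬ Reaches x y × ¬ Reaches y x) xs

  IsMaximumAntichain : List V → Set (v ⊔ p ⊔ a)
  IsMaximumAntichain xs = IsAntichain xs × (∀ ys → IsAntichain ys → length ys ℕ.≤ length xs)

module _ {n p a} (G : Digraph (Fin n) p a) where
  open Digraph G

  IsStronglyConnectedComponent : Subset n → Set (p ⊔ a)
  IsStronglyConnectedComponent A = ∃ λ u → Vertex u ×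
    (∀ v → v ∈ A ⇔ (Vertex v × Reaches G u v × Reaches G v u))

  condensation : Digraph (Subset n) (p ⊔ a) (p ⊔ a)
  condensation = record
    { Vertex = IsStronglyConnectedComponent
    ; Arc    = λ A B → IsStronglyConnectedComponent A × IsStronglyConnectedComponent B ×
                       A ≢ B × (∃₂ λ i j → i ∈ A × j ∈ B × Arc i j)
    }

module _ {c ℓ₁ ℓ₂} (F : OrderedField c ℓ₁ ℓ₂) where
  open OrderedField F

  record AsymmetricPseudometric (n : ℕ) : Set (c ⊔ ℓ₁ ⊔ ℓ₂) where
    field
      d           : Fin n → Fin n → Carrier
      nonNegative : ∀ u v → 0# ≤ d u v
      d-self      : ∀ u → d u u ≈ 0#
      triangle    : ∀ u v w → d u v ≤ d u w + d w v

module _ {c ℓ₁ ℓ₂} {F : OrderedField c ℓ₁ ℓ₂} {n : ℕ} (X : AsymmetricPseudometric F n) where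
  open OrderedField F
  open AsymmetricPseudometric X

  dmin dmax : Fin n → Fin n → Carrier
  dmin u v = min (d u v) (d v u)
  dmax u v = max (d u v) (d v u)

  -- div(S) = r. A relation, since the minimum is undefined when ∣ S ∣ < 2.
  IsDiv : Subset n → Carrier → Set (ℓ₁ ⊔ ℓ₂)
  IsDiv S r = (∃₂ λ u v → u ∈ S × v ∈ S × u ≢ v × d u v ≈ r) ×
              (∀ u v → u ∈ S → v ∈ S → u ≢ v → r ≤ d u v)

  IsOptimalValue : ℕ → Carrier → Set (c ⊔ ℓ₁ ⊔ ℓ₂)
  IsOptimalValue k r = (∃ λ O → ∣ O ∣ ≡ k × IsDiv O r) ×
                       (∀ S s → ∣ S ∣ ≡ k → IsDiv S s → s ≤ r)

  -- The algorithms leave choices open ("any unmarked point", "a maximum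
  -- antichain", ties, …). Each is the relation between its input and the
  -- outputs it can produce under some sequence of choices.

  -- The indices are the set of unmarked points and the centres still to be
  -- output.
  data ClusterLoop (R : Carrier) : Subset n → Subset n → Set (ℓ₁ ⊔ ℓ₂) where
    done : ∀ {T} → Empty T → ClusterLoop R T ∅
    mark : ∀ {T U′} x (A : Subset n) → x ∈ T →
           (∀ v → v ∈ A ⇔ (v ∈ T × dmax x v < R)) →
           ClusterLoop R (T ─ A) U′ →
           ClusterLoop R T (⁅ x ⁆ ∪ U′)

  Cluster : Carrier → Subset n → Set (ℓ₁ ⊔ ℓ₂)
  Cluster R U′ = ClusterLoop R full U′

  thresholdDigraph : Subset n → Carrier → Digraph (Fin n) Level.zero (ℓ₁ ⊔ ℓ₂)
  thresholdDigraph W σ = record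
    { Vertex = λ i → i ∈ W
    ; Arc    = λ i j → i ∈ W × j ∈ W × i ≢ j × d i j < σ
    }

  -- min of dmin u v over v in s ∷ ss
  dminTo : Fin n → Fin n → List (Fin n) → Carrier
  dminTo u s []       = dmin u s
  dminTo u s (t ∷ ts) = min (dmin u s) (dminTo u t ts)

  -- Lists of points greedily selected from I, most recent first; the first
  -- selection is arbitrary.
  data Greedy (I : List (Fin n)) : List (Fin n) → Set ℓ₂ where
    none  : Greedy I []
    first : ∀ {u} → u List.∈ I → Greedy I [ u ]
    next  : ∀ {u s ss} → Greedy I (s ∷ ss) → u List.∈ I → u List.∉ s ∷ ss →
            (∀ v → v List.∈ I → v List.∉ s ∷ ss → dminTo v s ss ≤ dminTo u s ss) →
            Greedy I (u ∷ s ∷ ss)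

  module _ (W : Subset n) (σ : Carrier) (k : ℕ) where
    private
      G  = thresholdDigraph W σ
      Gc = condensation G

    CycleChoice : Maybe (List (Fin n)) → Set (ℓ₁ ⊔ ℓ₂)
    CycleChoice (just C) = IsChordlessCycle G C
    CycleChoice nothing  = ¬ ∃ (IsCycle G)

    PathChoice : List (Subset n) → Set (ℓ₁ ⊔ ℓ₂)
    PathChoice L =
      (IsShortestPath Gc L × numArcs Gc L ≡ 2 ℕ.* k ∸ 1) ⊎
      (¬ (∃ λ P → IsShortestPath Gc P × numArcs Gc P ≡ 2 ℕ.* k ∸ 1) × IsLongestShortestPath Gc L)

    UseCycle : Maybe (List (Fin n)) → List (Subset n) → List (Subset n) → List (Fin n) → Set
    UseCycle mC M L C = mC ≡ just C × 2 ℕ.* length M ∸ 1 ℕ.≤ length C × length L ℕ.≤ length C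

    -- The lists I are duplicate-free, so length I is the cardinality |I|.
    data Independent (mC : Maybe (List (Fin n))) (M L : List (Subset n)) : List (Fin n) → Set where
      fromCycle     : ∀ {C} → UseCycle mC M L C → Independent mC M L (oddIndexed C)
      fromAntichain : ∀ {I} → ¬ ∃ (UseCycle mC M L) → length L ℕ.≤ 2 ℕ.* length M ∸ 1 →
                      Pointwise _∈_ I M → Independent mC M L I
      fromPath      : ∀ {I} → ¬ ∃ (UseCycle mC M L) → ¬ length L ℕ.≤ 2 ℕ.* length M ∸ 1 →
                      Pointwise _∈_ I (oddIndexed L) → Independent mC M L I

    data Select (I : List (Fin n)) : Maybe (Subset n) → Set ℓ₂ where
      success : ∀ {s} → k ℕ.≤ length I → Greedy I s → length s ≡ k →
                Select I (just (⋃ (map ⁅_⁆ s)))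
      failure : ¬ k ℕ.≤ length I → Select I nothing

    record Extract (out : Maybe (Subset n)) : Set (ℓ₁ ⊔ ℓ₂) where
      field
        mC          : Maybe (List (Fin n))
        M L         : List (Subset n)
        I           : List (Fin n)
        cycle       : CycleChoice mC
        antichain   : IsMaximumAntichain Gc M
        path        : PathChoice L
        independent : Independent mC M L I
        select      : Select I out

  IsThreshold : Carrier → Set (ℓ₁ ⊔ ℓ₂)
  IsThreshold R = ∃₂ λ i j → i ≢ j × 0# < d i j × d i j ≈ R

  Iteration : ℕ → Carrier → Maybe (Subset n) → Set (ℓ₁ ⊔ ℓ₂)
  Iteration k R out = ∃ λ U′ → Cluster R U′ × Extract U′ (R / fromℕ (2 ℕ.* k)) k out

  Best : List (Maybe (Subset n)) → Maybe (Subset n) → Set (c ⊔ ℓ₁ ⊔ ℓ₂)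
  Best outs (just S) = just S List.∈ outs ×
    (∀ T s t → just T List.∈ outs → IsDiv S s → IsDiv T t → t ≤ s)
  Best outs nothing  = Level.Lift (c ⊔ ℓ₁ ⊔ ℓ₂) (All (_≡ nothing) outs)

  record BAC (k : ℕ) (out : Maybe (Subset n)) : Set (c ⊔ ℓ₁ ⊔ ℓ₂) where
    field
      thresholds : List Carrier
      distinct   : SetoidUnique.Unique setoid thresholds
      complete   : ∀ R → SetoidMembership._∈_ setoid R thresholds ⇔ IsThreshold R
      outs       : List (Maybe (Subset n))
      iterations : Pointwise (Iteration k) thresholds outs
      best       : Best outs out

{-# OPTIONS --safe #-}

-- Every set returned in the iteration for R has pairwise distances at least
-- σ = R / 2k. Cluster leaves d_max ≥ R = 2kσ between points, so a cycle of the
-- σ-digraph has more than 2k arcs; its odd-indexed points then number more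
-- than k and contain at most one close pair (the two ends of an odd cycle),
-- which greedy selection avoids. Points of an antichain, or of every second
-- component on a shortest path of the acyclic condensation, are non-adjacent.
--
-- Let R be the least threshold with R* ≤ 3R. Distances below R are then below
-- R* / 3, so the cluster centres of the k optimal points are at distance at
-- least R from one another. If the σ-digraph is acyclic, either these centres
-- form an antichain, or one reaches another, by at least 2k arcs, and a
-- shortest path between them has a prefix with 2k − 1 arcs. In every case
-- |I| ≥ k, and R / 2k ≥ R* / 6k.
module Submission where

open import Defs
import Algebra.Construct.NaturalChoice.Max as Max
import Algebra.Construct.NaturalChoice.MaxOp as MaxOp
import Algebra.Construct.NaturalChoice.Min as Min
import Algebra.Construct.NaturalChoice.MinOp as MinOp
import Algebra.Properties.Ring as RingProperties
import Algebra.Properties.Semiring.Mult as Mult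
open import Data.Bool.Base using (true; false)
open import Data.Bool.Properties using () renaming (_≟_ to _≟ᵇ_)
open import Data.Fin.Base using (Fin; toℕ; zero; suc)
import Data.Fin.Base as Fin
import Data.Fin.Properties as Fin
open import Data.Fin.Subset using (Subset; inside; outside; _∈_; _∉_; _─_; _∪_; ⁅_⁆; ⋃; ∣_∣) renaming (⊤ to full)
import Data.Fin.Subset.Properties as Subset
open import Data.List.Base using (List; []; _∷_; [_]; _++_; length; lookup; map; head; last; allFin; filter; take; drop; deduplicate; cartesianProduct)
open import Data.List.Properties using (length-++; length-map; length-take; ++-assoc; ++-identityʳ; take++drop≡id)
import Data.List.Extrema as Extrema
import Data.List.Membership.DecPropositional as Dec∈
open import Data.List.Membership.Propositional using (find; lose) renaming (_∈_ to _∈ˡ_; _∉_ to _∉ˡ_)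
open import Data.List.Membership.Propositional.Properties using (∈-∃++; ∈-lookup; ∈-++⁺ˡ; ∈-++⁺ʳ; ∈-map⁺; ∈-map⁻; ∈-allFin; ∈-filter⁺; ∈-filter⁻; ∈-cartesianProduct⁺; ∈-deduplicate⁻)
import Data.List.Membership.Setoid as SetoidMembership
import Data.List.Membership.Setoid.Properties as Setoid∈
open import Data.List.Relation.Binary.Pointwise as Pointwise using (Pointwise; []; _∷_)
open import Data.List.Relation.Binary.Subset.Propositional using () renaming (_⊆_ to _⊆ˡ_)
open import Data.List.Relation.Unary.All as All using (All; []; _∷_)
import Data.List.Relation.Unary.All.Properties as All
open import Data.List.Relation.Unary.AllPairs as AllPairs using (AllPairs; []; _∷_)
import Data.List.Relation.Unary.AllPairs.Properties as AllPairs
open import Data.List.Relation.Unary.Any as Any using (here; there)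
open import Data.List.Relation.Unary.Linked as Linked using (Linked; []; [-]; _∷_)
import Data.List.Relation.Unary.Linked.Properties as Linked
import Data.List.Relation.Unary.Unique.DecPropositional as DecUnique
import Data.List.Relation.Unary.Unique.DecSetoid.Properties as DecSetoidUnique
open import Data.List.Relation.Unary.Unique.Propositional using (Unique)
open import Data.Maybe.Base using (Maybe; just; nothing)
open import Data.Maybe.Properties using () renaming (≡-dec to ≡-decᵐ)
open import Data.Maybe.Relation.Binary.Connected using (Connected)
open import Data.Nat.Base as ℕ using (ℕ; s≤s; z≤n)
open import Data.Nat.Induction using (<-wellFounded)
import Data.Nat.Properties as ℕ
open import Data.Product.Base as Product using (∃; ∃₂; _×_; _,_; proj₁; proj₂)
open import Data.Sum.Base as Sum using (_⊎_; inj₁; inj₂)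
open import Data.Vec.Base using ([]; _∷_; here; there)
import Data.Vec.Base as Vec
import Data.Vec.Properties as Vec
open import Function.Base using (_∘_; id)
open import Function.Bundles using (_⇔_; mk⇔; Equivalence)
open import Induction.WellFounded using (Acc; acc)
open import Level using (Level; lift)
open import Relation.Binary.Bundles using (DecTotalOrder)
open import Relation.Binary.Construct.Closure.ReflexiveTransitive using (ε; _◅_; _◅◅_)
open import Relation.Binary.Core using (Rel; REL)
open import Relation.Binary.Definitions using (DecidableEquality; Symmetric; tri<; tri≈; tri>) renaming (Decidable to Decidable₂)
import Relation.Binary.Properties.DecTotalOrder as DecTotalOrderProperties
open import Relation.Binary.PropositionalEquality as ≡ using (_≡_; _≢_; refl; sym; trans; cong; cong₂; subst; subst₂)
import Relation.Binary.Reasoning.Setoid as ≈-Reasoning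
open import Relation.Nullary using (¬_; Dec; yes; no; does; contradiction)
open import Relation.Nullary.Decidable using (map′; _×-dec_; _⊎-dec_; _→-dec_; ¬?; dec-true; decidable-stable)
open import Relation.Unary using (Pred; Decidable)

-- The radius one would like to cluster with is `R*` / 3: a detour between two optimal points
-- through their centres has three legs, two of them shorter than the radius. That value need not
-- occur as a distance, so the least threshold above it takes its place. One leg runs towards a
-- centre and another away from one; clustering by `dmax` bounds both. The factor 2k: a walk of m
-- arcs spans at most mσ, so spanning R takes at least 2k arcs, and keeping every second vertex
-- leaves k. Together with the three legs this gives 6k. The extraction compares |C|, 2|M| - 1 and
-- |L| before choosing a branch, so it suffices that one of the three is large: the branch taken
-- then yields k points, even if it is a different one. The choices of the algorithm are relations,
-- and a claim about all outputs is empty if there are none. Hence the existence of a run is proved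
-- as well, which accounts for most of the decision procedures and exhaustive searches.

private variable
  a b ℓ p q r : Level
  A : Set a
  B : Set b
  n : ℕ

-- Repetitions, splittings and shortcuts in lists.

lookup-injective : {xs : List A} → Unique xs → ∀ i j → lookup xs i ≡ lookup xs j → i ≡ j
lookup-injective (x∉ ∷ u) zero    zero    eq = refl
lookup-injective (x∉ ∷ u) zero    (suc j) eq = contradiction eq (All.lookup x∉ (∈-lookup j))
lookup-injective (x∉ ∷ u) (suc i) zero    eq = contradiction (sym eq) (All.lookup x∉ (∈-lookup i))
lookup-injective (x∉ ∷ u) (suc i) (suc j) eq = cong suc (lookup-injective u i j eq)

-- Pigeonhole: sending a position in `xs` to the position of its entry in `ys` is injective.
Unique∧⊆⇒length≤ : {xs ys : List A} → Unique xs → xs ⊆ˡ ys → length xs ℕ.≤ length ys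
Unique∧⊆⇒length≤ u xs⊆ys = Fin.injective⇒≤ λ {i} {j} eq → lookup-injective u i j
  (Setoid∈.index-injective (≡.setoid _) (xs⊆ys (∈-lookup i)) (xs⊆ys (∈-lookup j)) eq)

Unique∧length<⇒∃∉ : DecidableEquality A → {xs ys : List A} → Unique xs →
                    length ys ℕ.< length xs → ∃ λ x → x ∈ˡ xs × x ∉ˡ ys
Unique∧length<⇒∃∉ _≟_ {xs} {ys} u lt with Any.any? (λ x → ¬? (x ∈? ys)) xs
  where open Dec∈ _≟_ using (_∈?_)
... | yes any = find any
... | no ¬any = contradiction (Unique∧⊆⇒length≤ u λ {x} x∈xs →
        decidable-stable (x ∈? ys) (λ x∉ys → ¬any (lose x∈xs x∉ys))) (ℕ.<⇒≱ lt)
  where open Dec∈ _≟_ using (_∈?_)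

¬Unique⇒repetition : DecidableEquality A → (xs : List A) → ¬ Unique xs →
                     ∃₂ λ ps x → ∃₂ λ qs rs → xs ≡ ps ++ x ∷ qs ++ x ∷ rs
¬Unique⇒repetition _≟_ []       ¬u = contradiction [] ¬u
¬Unique⇒repetition _≟_ (x ∷ xs) ¬u with Dec∈._∈?_ _≟_ x xs
... | yes x∈xs = let qs , rs , eq = ∈-∃++ x∈xs in [] , x , qs , rs , cong (x ∷_) eq
... | no  x∉xs =
  let ps , y , qs , rs , eq = ¬Unique⇒repetition _≟_ xs
        (λ u → ¬u (All.tabulate (λ y∈xs x≡y → x∉xs (subst (_∈ˡ xs) (sym x≡y) y∈xs)) ∷ u))
  in x ∷ ps , y , qs , rs , cong (x ∷_) eq

splitAt-lookup : (xs : List A) (i : Fin (length xs)) →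
                 ∃₂ λ ps rs → xs ≡ ps ++ lookup xs i ∷ rs × length ps ≡ toℕ i
splitAt-lookup (x ∷ xs) zero    = [] , xs , refl , refl
splitAt-lookup (x ∷ xs) (suc i) =
  let ps , rs , eq , len = splitAt-lookup xs i in x ∷ ps , rs , cong (x ∷_) eq , cong ℕ.suc len

splitAt-lookup₂ : (xs : List A) (i j : Fin (length xs)) → toℕ i ℕ.< toℕ j →
                  ∃ λ ps → ∃₂ λ qs rs → xs ≡ ps ++ lookup xs i ∷ qs ++ lookup xs j ∷ rs ×
                  length ps ≡ toℕ i × ℕ.suc (length ps ℕ.+ length qs) ≡ toℕ j
splitAt-lookup₂ (x ∷ xs) zero    (suc j) lt =
  let qs , rs , eq , len = splitAt-lookup xs j in
  [] , qs , rs , cong (x ∷_) eq , refl , cong ℕ.suc len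
splitAt-lookup₂ (x ∷ xs) (suc i) (suc j) (s≤s lt) =
  let ps , qs , rs , eq , len₁ , len₂ = splitAt-lookup₂ xs i j lt in
  x ∷ ps , qs , rs , cong (x ∷_) eq , cong ℕ.suc len₁ , cong ℕ.suc len₂

last-++-∷ : (xs : List A) {y : A} {ys : List A} → last (xs ++ y ∷ ys) ≡ last (y ∷ ys)
last-++-∷ []           = refl
last-++-∷ (x ∷ [])     = refl
last-++-∷ (x ∷ z ∷ xs) = last-++-∷ (z ∷ xs)

last-++-cong : {xs ys : List A} → last xs ≡ last ys → (zs : List A) → last (xs ++ zs) ≡ last (ys ++ zs)
last-++-cong {xs = xs} {ys} eq []       =
  trans (cong last (++-identityʳ xs)) (trans eq (sym (cong last (++-identityʳ ys))))
last-++-cong {xs = xs} {ys} eq (z ∷ zs) = trans (last-++-∷ xs) (sym (last-++-∷ ys))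

head-++-∷ : (xs : List A) {y : A} {ys zs : List A} → head (xs ++ y ∷ ys) ≡ head (xs ++ y ∷ zs)
head-++-∷ []       = refl
head-++-∷ (x ∷ xs) = refl

++-∷≢[] : (xs : List A) {y : A} {ys : List A} → xs ++ y ∷ ys ≢ []
++-∷≢[] []       ()
++-∷≢[] (x ∷ xs) ()

module _ {R : Rel A ℓ} where

  Linked-++⁻ˡ : ∀ xs {ys} → Linked R (xs ++ ys) → Linked R xs
  Linked-++⁻ˡ []           l       = []
  Linked-++⁻ˡ (x ∷ [])     l       = [-]
  Linked-++⁻ˡ (x ∷ y ∷ xs) (r ∷ l) = r ∷ Linked-++⁻ˡ (y ∷ xs) l

  Linked-++⁻ʳ : ∀ xs {ys} → Linked R (xs ++ ys) → Linked R ys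
  Linked-++⁻ʳ []       l = l
  Linked-++⁻ʳ (x ∷ xs) l = Linked-++⁻ʳ xs (Linked.tail l)

  Linked-++⁻-connected : ∀ x xs {ys} → Linked R (x ∷ xs ++ ys) → Connected R (last (x ∷ xs)) (head ys)
  Linked-++⁻-connected x []       l       = Linked.head′ l
  Linked-++⁻-connected x (y ∷ xs) (_ ∷ l) = Linked-++⁻-connected y xs l

  Linked-shortcut : ∀ ps {x qs y rs} → R x y →
                    Linked R (ps ++ x ∷ qs ++ y ∷ rs) → Linked R (ps ++ x ∷ y ∷ rs)
  Linked-shortcut []           {x} {qs} Rxy l = Rxy ∷ Linked-++⁻ʳ (x ∷ qs) l
  Linked-shortcut (z ∷ [])     Rxy (r ∷ l) = r ∷ Linked-shortcut [] Rxy l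
  Linked-shortcut (z ∷ w ∷ ps) Rxy (r ∷ l) = r ∷ Linked-shortcut (w ∷ ps) Rxy l

  AllPairs-++⁻ʳ : ∀ xs {ys} → AllPairs R (xs ++ ys) → AllPairs R ys
  AllPairs-++⁻ʳ []       ps       = ps
  AllPairs-++⁻ʳ (x ∷ xs) (_ ∷ ps) = AllPairs-++⁻ʳ xs ps

  AllPairs-++⁻ˡ : ∀ xs {ys} → AllPairs R (xs ++ ys) → AllPairs R xs
  AllPairs-++⁻ˡ []       ps       = []
  AllPairs-++⁻ˡ (x ∷ xs) (p ∷ ps) = All.++⁻ˡ xs p ∷ AllPairs-++⁻ˡ xs ps

  AllPairs-shortcut : ∀ ps {x} qs {ys} → AllPairs R (ps ++ x ∷ qs ++ ys) → AllPairs R (ps ++ x ∷ ys)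
  AllPairs-shortcut []       qs (p ∷ l) = All.++⁻ʳ qs p ∷ AllPairs-++⁻ʳ qs l
  AllPairs-shortcut (z ∷ ps) qs (p ∷ l) = All-shortcut ps qs p ∷ AllPairs-shortcut ps qs l
    where
    All-shortcut : ∀ {P : Pred A ℓ} ps {x} qs {ys} → All P (ps ++ x ∷ qs ++ ys) → All P (ps ++ x ∷ ys)
    All-shortcut ps qs pr with All.++⁻ ps pr
    ... | l , px ∷ r = All.++⁺ l (px ∷ All.++⁻ʳ qs r)

  AllPairs-lookup : Symmetric R → ∀ {xs x y} → AllPairs R xs → x ∈ˡ xs → y ∈ˡ xs → x ≢ y → R x y
  AllPairs-lookup R-sym (p ∷ ps) (here refl) (here refl) x≢y = contradiction refl x≢y
  AllPairs-lookup R-sym (p ∷ ps) (here refl) (there y∈)  x≢y = All.lookup p y∈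
  AllPairs-lookup R-sym (p ∷ ps) (there x∈)  (here refl) x≢y = R-sym (All.lookup p x∈)
  AllPairs-lookup R-sym (p ∷ ps) (there x∈)  (there y∈)  x≢y = AllPairs-lookup R-sym ps x∈ y∈ x≢y

length-shortcut : (ps : List A) {x : A} (qs : List A) {rs : List A} →
                  length (ps ++ x ∷ qs ++ rs) ≡ length qs ℕ.+ length (ps ++ x ∷ rs)
length-shortcut []       qs {rs} = trans (cong ℕ.suc (length-++ qs)) (sym (ℕ.+-suc _ _))
length-shortcut (z ∷ ps) qs      = trans (cong ℕ.suc (length-shortcut ps qs)) (sym (ℕ.+-suc _ _))

-- Exhaustive search over duplicate-free lists.

module FiniteSearch {V : Set a} (_≟_ : DecidableEquality V)
                    (enum : List V) (∈-enum : ∀ x → x ∈ˡ enum) where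

  any? : {P : Pred V p} → Decidable P → Dec (∃ P)
  any? P? = map′ Any.satisfied (λ (x , px) → lose (∈-enum x) px) (Any.any? P? enum)

  anyOfLength? : {P : Pred (List V) p} → Decidable P → ∀ m → Dec (∃ λ xs → length xs ≡ m × P xs)
  anyOfLength? P? ℕ.zero    = map′ (λ p → [] , refl , p) (λ { ([] , _ , p) → p }) (P? [])
  anyOfLength? P? (ℕ.suc m) =
    map′ (λ (x , xs , len , p) → x ∷ xs , cong ℕ.suc len , p)
         (λ { (x ∷ xs , len , p) → x , xs , ℕ.suc-injective len , p })
         (any? λ x → anyOfLength? (P? ∘ (x ∷_)) m)

  module _ {P : Pred (List V) p} (P? : Decidable P) (P⇒Unique : ∀ {xs} → P xs → Unique xs) where

    private
      bounded : ∀ {xs} → P xs → length xs ℕ.≤ length enum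
      bounded p = Unique∧⊆⇒length≤ (P⇒Unique p) (λ {x} _ → ∈-enum x)

    -- A duplicate-free list is no longer than `enum`, so only finitely many lengths have to be
    -- tried.
    anyUnique? : Dec (∃ P)
    anyUnique? = map′ (λ (m , _ , xs , _ , p) → xs , p)
                      (λ (xs , p) → length xs , s≤s (bounded p) , xs , refl , p)
                      (ℕ.anyUpTo? (anyOfLength? P?) (ℕ.suc (length enum)))

  longest : {P : Pred (List V) p} → Decidable P → (∀ {xs} → P xs → Unique xs) →
            ∃ P → ∃ λ xs → P xs × (∀ ys → P ys → length ys ℕ.≤ length xs)
  longest {P = P} P? P⇒Unique (xs , p) = go xs p (length enum) (ℕ.m≤n+m _ (length xs))
    where
    -- Each improvement lengthens `xs` and uses up one unit of `fuel`; with none left, `xs` is as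
    -- long as `enum`.
    go : ∀ xs → P xs → ∀ fuel → length enum ℕ.≤ length xs ℕ.+ fuel →
         ∃ λ xs → P xs × (∀ ys → P ys → length ys ℕ.≤ length xs)
    go xs p ℕ.zero       h = xs , p , λ ys q → ℕ.≤-trans
      (Unique∧⊆⇒length≤ (P⇒Unique q) (λ {x} _ → ∈-enum x)) (subst (_ ℕ.≤_) (ℕ.+-identityʳ _) h)
    go xs p (ℕ.suc fuel) h
      with anyUnique? (λ ys → P? ys ×-dec (length xs ℕ.<? length ys)) (P⇒Unique ∘ proj₁)
    ... | yes (ys , q , lt) = go ys q fuel (ℕ.≤-trans h (subst (ℕ._≤ length ys ℕ.+ fuel)
                                (sym (ℕ.+-suc (length xs) fuel)) (ℕ.+-monoˡ-≤ fuel lt)))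
    ... | no  ¬any          = xs , p , λ ys q → ℕ.≮⇒≥ (λ lt → ¬any (ys , q , lt))

-- Reachability, shortest paths, chordless cycles and antichains in finite digraphs.

module FiniteDigraph {V : Set a} (_≟_ : DecidableEquality V)
                     (enum : List V) (∈-enum : ∀ x → x ∈ˡ enum)
                     (G : Digraph V p q) where
  open Digraph G
  open FiniteSearch _≟_ enum ∈-enum

  module _ (Arc? : Decidable₂ Arc) where

    -- Floyd–Warshall: reachability with all intermediate vertices in the list.
    private
      ReachesVia : List V → V → V → Set _
      ReachesVia []       x y = x ≡ y ⊎ Arc x y
      ReachesVia (z ∷ zs) x y = ReachesVia zs x y ⊎ ReachesVia zs x z × ReachesVia zs z y

      via? : ∀ zs → Decidable₂ (ReachesVia zs)
      via? []       x y = (x ≟ y) ⊎-dec Arc? x y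
      via? (z ∷ zs) x y = via? zs x y ⊎-dec (via? zs x z ×-dec via? zs z y)

      via⇒reaches : ∀ zs {x y} → ReachesVia zs x y → Reaches G x y
      via⇒reaches []       (inj₁ refl)    = ε
      via⇒reaches []       (inj₂ arc)     = arc ◅ ε
      via⇒reaches (z ∷ zs) (inj₁ v)       = via⇒reaches zs v
      via⇒reaches (z ∷ zs) (inj₂ (v , w)) = via⇒reaches zs v ◅◅ via⇒reaches zs w

      via-base : ∀ zs {x y} → x ≡ y ⊎ Arc x y → ReachesVia zs x y
      via-base []       b = b
      via-base (z ∷ zs) b = inj₁ (via-base zs b)

      via-trans : ∀ zs {x y z} → z ∈ˡ zs → ReachesVia zs x z → ReachesVia zs z y → ReachesVia zs x y
      via-trans (w ∷ zs) (here refl) u v = inj₂ (Sum.[ id , proj₁ ] u , Sum.[ id , proj₂ ] v)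
      via-trans (w ∷ zs) (there z∈) (inj₁ u)         (inj₁ v)         = inj₁ (via-trans zs z∈ u v)
      via-trans (w ∷ zs) (there z∈) (inj₁ u)         (inj₂ (v₁ , v₂)) = inj₂ (via-trans zs z∈ u v₁ , v₂)
      via-trans (w ∷ zs) (there z∈) (inj₂ (u₁ , u₂)) (inj₁ v)         = inj₂ (u₁ , via-trans zs z∈ u₂ v)
      -- Both halves pass through `w`: the loop from `w` through `z` back to `w` is cut out.
      via-trans (w ∷ zs) (there z∈) (inj₂ (u₁ , _))  (inj₂ (_ , v₂))  = inj₂ (u₁ , v₂)

      reaches⇒via : ∀ {x y} → Reaches G x y → ReachesVia enum x y
      reaches⇒via ε              = via-base enum (inj₁ refl)
      reaches⇒via (_◅_ {j = z} arc s) =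
        via-trans enum (∈-enum z) (via-base enum (inj₂ arc)) (reaches⇒via s)

    reaches? : Decidable₂ (Reaches G)
    reaches? x y = map′ (via⇒reaches enum) reaches⇒via (via? enum x y)

  module _ (Vertex? : Decidable Vertex) (Arc? : Decidable₂ Arc)
           (Arc⇒Vertex : ∀ {x y} → Arc x y → Vertex x × Vertex y) where

    open DecUnique _≟_ using (unique?)

    isPath? : Decidable (IsPath G)
    isPath? []       = no λ (ne , _) → ne refl
    isPath? (x ∷ xs) = map′ ((λ ()) ,_) proj₂
      (All.all? Vertex? (x ∷ xs) ×-dec Linked.linked? Arc? (x ∷ xs) ×-dec unique? (x ∷ xs))

    isPath⇒Unique : ∀ {xs} → IsPath G xs → Unique xs
    isPath⇒Unique (_ , _ , _ , u) = u

    private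
      ShorterPath : List V → List V → Set _
      ShorterPath xs ys = IsPath G ys × head ys ≡ head xs × last ys ≡ last xs × numArcs G ys ℕ.< numArcs G xs

      shorterPath? : ∀ xs → Dec (∃ (ShorterPath xs))
      shorterPath? xs = anyUnique?
        (λ ys → isPath? ys ×-dec ≡-decᵐ _≟_ (head ys) (head xs) ×-dec ≡-decᵐ _≟_ (last ys) (last xs) ×-dec
                (numArcs G ys ℕ.<? numArcs G xs))
        (isPath⇒Unique ∘ proj₁)

      ¬shorter⇒shortest : ∀ {xs} → IsPath G xs → ¬ ∃ (ShorterPath xs) → IsShortestPath G xs
      ¬shorter⇒shortest path ¬shorter =
        path , λ ys q h l → ℕ.≮⇒≥ λ lt → ¬shorter (ys , q , h , l , lt)

    isShortestPath? : Decidable (IsShortestPath G)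
    isShortestPath? xs with isPath? xs | shorterPath? xs
    ... | no ¬path | _       = no (¬path ∘ proj₁)
    ... | yes path | no ¬any = yes (¬shorter⇒shortest path ¬any)
    ... | yes path | yes (ys , q , h , l , lt) = no λ (_ , min) → ℕ.<⇒≱ lt (min ys q h l)

    -- Loop erasure: if `x` already lies on the path obtained from the rest of the walk, that path
    -- from `x` onwards serves instead; the ends stay the same and no arc is added.
    walk⇒path : ∀ x xs → All Vertex (x ∷ xs) → Linked Arc (x ∷ xs) →
                ∃ λ ys → IsPath G (x ∷ ys) × last (x ∷ ys) ≡ last (x ∷ xs) × length ys ℕ.≤ length xs
    walk⇒path x []       vs       ls       = [] , ((λ ()) , vs , ls , [] ∷ []) , refl , z≤n
    walk⇒path x (y ∷ xs) (v ∷ vs) (l ∷ ls) with walk⇒path y xs vs ls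
    ... | ys , (_ , vs′ , ls′ , u) , eq , le with Dec∈._∈?_ _≟_ x (y ∷ ys)
    ... | no x∉ = y ∷ ys , ((λ ()) , v ∷ vs′ , l ∷ ls′ ,
                  All.tabulate (λ z∈ x≡z → x∉ (subst (_∈ˡ y ∷ ys) (sym x≡z) z∈)) ∷ u) , eq , s≤s le
    ... | yes x∈ with as , bs , split ← ∈-∃++ x∈ =
      bs ,
      ((λ ()) , All.++⁻ʳ as (subst (All Vertex) split vs′) , Linked-++⁻ʳ as (subst (Linked Arc) split ls′) ,
       AllPairs-++⁻ʳ as (subst Unique split u)) ,
      trans (sym (last-++-∷ as)) (trans (cong last (sym split)) eq) ,
      ℕ.≤-trans (ℕ.≤-pred (ℕ.≤-trans (ℕ.m≤n+m (ℕ.suc (length bs)) (length as))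
        (ℕ.≤-reflexive (trans (sym (length-++ as)) (cong length (sym split)))))) (ℕ.≤-trans le (ℕ.n≤1+n _))

    reaches⇒walk : ∀ {x y} → Vertex x → Reaches G x y →
                   ∃ λ xs → All Vertex (x ∷ xs) × Linked Arc (x ∷ xs) × last (x ∷ xs) ≡ just y
    reaches⇒walk v ε = [] , v ∷ [] , [-] , refl
    reaches⇒walk v (_◅_ {j = z} arc s) =
      let xs , vs , ls , eq = reaches⇒walk (proj₂ (Arc⇒Vertex arc)) s in z ∷ xs , v ∷ vs , arc ∷ ls , eq

    reaches⇒shortestPath : ∀ {x y} → Vertex x → Reaches G x y →
                           ∃ λ xs → IsShortestPath G (x ∷ xs) × last (x ∷ xs) ≡ just y
    reaches⇒shortestPath {x} {y} v s =
      let xs , vs , ls , eq = reaches⇒walk v s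
          ys , path , eq′ , _ = walk⇒path x xs vs ls
      in shorten ys path (trans eq′ eq) (<-wellFounded _)
      where
      shorten : ∀ ys → IsPath G (x ∷ ys) → last (x ∷ ys) ≡ just y → Acc ℕ._<_ (length ys) →
                ∃ λ xs → IsShortestPath G (x ∷ xs) × last (x ∷ xs) ≡ just y
      shorten ys path eq (acc rec) with shorterPath? (x ∷ ys)
      ... | no ¬any = ys , ¬shorter⇒shortest path ¬any , eq
      ... | yes (z ∷ zs , path′ , refl , l , lt) = shorten zs path′ (trans l eq) (rec lt)

    -- A competitor `zs` of the prefix may meet `ys`, so `zs ++ ys` is only a walk. Erasing its
    -- loops gives a path to compare with the given shortest one, and the contribution of `ys`
    -- cancels.
    prefix-shortest : ∀ x xs ys → IsShortestPath G (x ∷ xs ++ ys) → IsShortestPath G (x ∷ xs)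
    prefix-shortest x xs ys ((_ , vs , ls , u) , min) =
      ((λ ()) , All.++⁻ˡ (x ∷ xs) vs , Linked-++⁻ˡ (x ∷ xs) ls , AllPairs-++⁻ˡ (x ∷ xs) u) , min′
      where
      min′ : ∀ zs → IsPath G zs → head zs ≡ head (x ∷ xs) → last zs ≡ last (x ∷ xs) →
             length xs ℕ.≤ numArcs G zs
      min′ []       (ne , _)            h    l = contradiction refl ne
      min′ (_ ∷ zs) (_ , vs′ , ls′ , _) refl l =
        let ws , path , l′ , le = walk⇒path x (zs ++ ys)
              (All.++⁺ vs′ (All.++⁻ʳ (x ∷ xs) vs))
              (Linked.++⁺ ls′ (subst (λ e → Connected Arc e (head ys)) (sym l) (Linked-++⁻-connected x xs ls))
                             (Linked-++⁻ʳ (x ∷ xs) ls))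
        in ℕ.+-cancelʳ-≤ (length ys) _ _ (subst₂ ℕ._≤_ (length-++ xs) (length-++ zs)
             (ℕ.≤-trans (min (x ∷ ws) path refl (trans l′ (last-++-cong {xs = x ∷ zs} {x ∷ xs} l ys))) le))

    -- The arc would bypass `qs`, keeping both ends of the path and saving `length qs` arcs.
    shortest⇒no-shortcut : ∀ ps {x qs y rs} → qs ≢ [] → IsShortestPath G (ps ++ x ∷ qs ++ y ∷ rs) → ¬ Arc x y
    shortest⇒no-shortcut ps {x} {qs} {y} {rs} qs≢[] ((_ , vs , ls , u) , min) arc =
      ℕ.<⇒≱ lt (min (ps ++ x ∷ y ∷ rs)
        (nonempty , All.++⁺ (All.++⁻ˡ ps vs) (All.head (All.++⁻ʳ ps vs) ∷ All.++⁻ʳ qs (All.tail (All.++⁻ʳ ps vs))) ,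
         Linked-shortcut ps arc ls , AllPairs-shortcut ps qs u)
        (head-++-∷ ps) (trans (last-++-∷ ps) (sym (trans (last-++-∷ ps) (last-++-∷ (x ∷ qs))))))
      where
      nonempty : ps ++ x ∷ y ∷ rs ≢ []
      nonempty = ++-∷≢[] ps
      positive : ∀ {zs : List V} → zs ≢ [] → 0 ℕ.< length zs
      positive {[]}    ne = contradiction refl ne
      positive {_ ∷ _} _  = s≤s z≤n
      lt : numArcs G (ps ++ x ∷ y ∷ rs) ℕ.< numArcs G (ps ++ x ∷ qs ++ y ∷ rs)
      lt = subst (λ m → numArcs G (ps ++ x ∷ y ∷ rs) ℕ.< m ℕ.∸ 1) (sym (length-shortcut ps qs))
             (ℕ.∸-monoˡ-< (ℕ.m<n+m _ (positive qs≢[])) (positive nonempty))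

    -- The return to the first vertex is not listed, as in `IsCycle`, but vertices may repeat.
    -- Cutting at a repetition or along a chord visibly preserves this weaker notion.
    IsClosedWalk : List V → Set _
    IsClosedWalk zs = ∃ λ x → head zs ≡ just x × Linked Arc (zs ++ [ x ])

    isCycle? : Decidable (IsCycle G)
    isCycle? []       = no λ ()
    isCycle? (x ∷ xs) = (2 ℕ.≤? length (x ∷ xs)) ×-dec All.all? Vertex? (x ∷ xs) ×-dec unique? (x ∷ xs) ×-dec
                        Linked.linked? Arc? (x ∷ xs ++ [ x ])

    isCycle⇒Unique : ∀ {xs} → IsCycle G xs → Unique xs
    isCycle⇒Unique {_ ∷ _} (_ , _ , u , _) = u

    cycle? : Dec (∃ (IsCycle G))
    cycle? = anyUnique? isCycle? isCycle⇒Unique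

    isCycle⇒closedWalk : ∀ {xs} → IsCycle G xs → IsClosedWalk xs
    isCycle⇒closedWalk {x ∷ xs} (_ , _ , _ , ls) = x , refl , ls

    private
      cyclicSuc? : ∀ {ℓ} → Decidable₂ (CyclicSuc {ℓ})
      cyclicSuc? {ℓ} i j = (ℕ.suc (toℕ i) ℕ.≟ toℕ j) ⊎-dec ((ℕ.suc (toℕ i) ℕ.≟ ℓ) ×-dec (toℕ j ℕ.≟ 0))

      Chord : ∀ zs (i j : Fin (length zs)) → Set _
      Chord zs i j = i ≢ j × ¬ Consecutive i j × Arc (lookup zs i) (lookup zs j)

      chord? : ∀ zs → Dec (∃₂ (Chord zs))
      chord? zs = Fin.any? λ i → Fin.any? λ j → ¬? (i Fin.≟ j) ×-dec
        ¬? (cyclicSuc? i j ⊎-dec cyclicSuc? j i) ×-dec Arc? (lookup zs i) (lookup zs j)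

    module _ (Arc-irrefl : ∀ {x} → ¬ Arc x x) where

      private
        unique⇒isCycle : ∀ {zs} → IsClosedWalk zs → Unique zs → IsCycle G zs
        unique⇒isCycle {_ ∷ []}     (x , refl , l ∷ _) u = contradiction l Arc-irrefl
        unique⇒isCycle {_ ∷ y ∷ zs} (x , refl , ls)    u =
          s≤s (s≤s z≤n) , vertices x (y ∷ zs) ls , u , ls
          where
          vertices : ∀ x xs {z} → Linked Arc (x ∷ xs ++ [ z ]) → All Vertex (x ∷ xs)
          vertices x []       (l ∷ _)  = proj₁ (Arc⇒Vertex l) ∷ []
          vertices x (y ∷ xs) (l ∷ ls) = proj₁ (Arc⇒Vertex l) ∷ vertices y xs ls

        -- The stretch from one occurrence of a vertex to the next is closed by itself.
        shorten-repetition : ∀ {zs} → IsClosedWalk zs → ¬ Unique zs →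
                             ∃ λ ws → IsClosedWalk ws × length ws ℕ.< length zs
        shorten-repetition {zs} (x , _ , ls) ¬u
          with ps , y , qs , rs , refl ← ¬Unique⇒repetition _≟_ zs ¬u =
          y ∷ qs , (y , refl , Linked-++⁻ˡ (y ∷ qs ++ [ y ]) (subst (Linked Arc) reassoc suffix)) ,
          ℕ.≤-trans (s≤s (ℕ.≤-trans (ℕ.m≤m+n _ (length rs)) (ℕ.≤-reflexive (sym
            (trans (length-++ qs) (ℕ.+-suc _ _))))))
            (ℕ.≤-trans (ℕ.m≤n+m _ (length ps)) (ℕ.≤-reflexive (sym (length-++ ps))))
          where
          suffix : Linked Arc (y ∷ (qs ++ y ∷ rs) ++ [ x ])
          suffix = Linked-++⁻ʳ ps (subst (Linked Arc) (++-assoc ps (y ∷ qs ++ y ∷ rs) [ x ]) ls)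
          reassoc : y ∷ (qs ++ y ∷ rs) ++ [ x ] ≡ (y ∷ qs ++ [ y ]) ++ rs ++ [ x ]
          reassoc = cong (y ∷_) (trans (++-assoc qs (y ∷ rs) [ x ]) (sym (++-assoc qs [ y ] (rs ++ [ x ]))))

        -- A chord to a later position bypasses the vertices in between; there are some because the
        -- ends are not consecutive.
        shorten-forward : ∀ {zs} i j → toℕ i ℕ.< toℕ j → IsClosedWalk zs → Chord zs i j →
                          ∃ λ ws → IsClosedWalk ws × length ws ℕ.< length zs
        shorten-forward {zs} i j i<j (x , h , ls) (_ , ¬cons , arc)
          with ps , qs , rs , split , len₁ , len₂ ← splitAt-lookup₂ zs i j i<j =
          ps ++ lookup zs i ∷ lookup zs j ∷ rs ,
          (x , trans (head-++-∷ ps) (trans (cong head (sym split)) h) ,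
           subst (Linked Arc) (sym (++-assoc ps _ [ x ]))
             (Linked-shortcut ps arc (subst (Linked Arc) reassoc ls))) ,
          subst (length (ps ++ lookup zs i ∷ lookup zs j ∷ rs) ℕ.<_) (sym (trans (cong length split) (length-shortcut ps qs))) (ℕ.m<n+m _ (ℕ.n≢0⇒n>0 qs≢0))
          where
          reassoc : zs ++ [ x ] ≡ ps ++ lookup zs i ∷ qs ++ lookup zs j ∷ rs ++ [ x ]
          reassoc = trans (cong (_++ [ x ]) split) (trans (++-assoc ps _ [ x ])
                      (cong (λ e → ps ++ lookup zs i ∷ e) (++-assoc qs _ [ x ])))
          qs≢0 : length qs ≢ 0
          qs≢0 eq = ¬cons (inj₁ (inj₁ (trans (cong ℕ.suc (sym len₁))
            (trans (cong ℕ.suc (sym (trans (cong (length ps ℕ.+_) eq) (ℕ.+-identityʳ _)))) len₂))))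

        -- A chord to an earlier position closes up the stretch between its ends, and everything
        -- outside that stretch is dropped.
        shorten-backward : ∀ {zs} i j → toℕ j ℕ.< toℕ i → IsClosedWalk zs → Chord zs i j →
                           ∃ λ ws → IsClosedWalk ws × length ws ℕ.< length zs
        shorten-backward {zs} i j j<i (x , h , ls) (_ , ¬cons , arc)
          with ps , qs , rs , split , len₁ , len₂ ← splitAt-lookup₂ zs j i j<i =
          lookup zs j ∷ qs ++ [ lookup zs i ] ,
          (lookup zs j , refl , subst (Linked Arc) (sym (++-assoc (lookup zs j ∷ qs) _ _))
            (Linked.++⁺ (Linked-++⁻ˡ (lookup zs j ∷ qs) body) (Linked-++⁻-connected (lookup zs j) qs body)
              (arc ∷ [-]))) ,
          subst₂ ℕ._<_ (sym (cong ℕ.suc (trans (length-++ qs) (ℕ.+-comm _ 1)))) (sym total)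
            (strict (length ps) (length rs) refl refl)
          where
          body : Linked Arc (lookup zs j ∷ qs ++ lookup zs i ∷ rs)
          body = Linked-++⁻ʳ ps (subst (Linked Arc) split (Linked-++⁻ˡ zs ls))
          total : length zs ≡ length ps ℕ.+ ℕ.suc (length qs ℕ.+ ℕ.suc (length rs))
          total = trans (cong length split) (trans (length-++ ps)
                    (cong (λ e → length ps ℕ.+ ℕ.suc e) (length-++ qs)))
          strict : ∀ a b → length ps ≡ a → length rs ≡ b →
                   2 ℕ.+ length qs ℕ.< length ps ℕ.+ ℕ.suc (length qs ℕ.+ ℕ.suc (length rs))
          -- Nothing lies outside the stretch only if the chord leads from the last position to the
          -- first, and those are consecutive in the cyclic order.
          strict ℕ.zero ℕ.zero p r = contradiction (inj₁ (inj₂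
            ( trans (cong ℕ.suc (trans (sym len₂) (cong (λ e → ℕ.suc (e ℕ.+ length qs)) p)))
                (sym (trans total (trans (cong₂ (λ e f → e ℕ.+ ℕ.suc (length qs ℕ.+ ℕ.suc f)) p r)
                  (cong ℕ.suc (ℕ.+-comm (length qs) 1)))))
            , trans (sym len₁) p))) ¬cons
          strict ℕ.zero (ℕ.suc b) p r rewrite p | r =
            s≤s (subst (2 ℕ.+ length qs ℕ.≤_) (ℕ.+-comm (2 ℕ.+ b) (length qs)) (s≤s (s≤s (ℕ.m≤n+m _ b))))
          strict (ℕ.suc a) b p r rewrite p | r =
            s≤s (ℕ.≤-trans (s≤s (subst (ℕ.suc (length qs) ℕ.≤_) (sym (ℕ.+-suc (length qs) b)) (s≤s (ℕ.m≤m+n _ b))))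
                           (ℕ.m≤n+m _ a))

      -- Descent on the length: a repetition or a chord gives a strictly shorter closed walk.
      -- Irreflexivity of `Arc` keeps the descent from ending in a single vertex.
      closedWalk⇒chordlessCycle : ∀ {zs} → IsClosedWalk zs → ∃ (IsChordlessCycle G)
      closedWalk⇒chordlessCycle w = go w (<-wellFounded _)
        where
        go : ∀ {zs} → IsClosedWalk zs → Acc ℕ._<_ (length zs) → ∃ (IsChordlessCycle G)
        go {zs} w (acc rec) with unique? zs
        ... | no ¬u = let ws , w′ , lt = shorten-repetition w ¬u in go w′ (rec lt)
        ... | yes u with chord? zs
        ... | no ¬any = zs , unique⇒isCycle w u , λ i j i≢j ¬cons arc → ¬any (i , j , i≢j , ¬cons , arc)
        ... | yes (i , j , ch@(i≢j , _)) with ℕ.<-cmp (toℕ i) (toℕ j)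
        ...   | tri< i<j _ _ = let ws , w′ , lt = shorten-forward i j i<j w ch in go w′ (rec lt)
        ...   | tri≈ _ eq _  = contradiction (Fin.toℕ-injective eq) i≢j
        ...   | tri> _ _ j<i = let ws , w′ , lt = shorten-backward i j j<i w ch in go w′ (rec lt)

      arc∧reaches⇒cycle : ∀ {x y} → Arc x y → Reaches G y x → ∃ (IsCycle G)
      arc∧reaches⇒cycle {x} arc s =
        Product.map₂ proj₁ (closedWalk⇒chordlessCycle (x , refl , proj₂ (closing arc s)))
        where
        closing : ∀ {v w u} → Arc v w → Reaches G w u → ∃ λ zs → Linked Arc (v ∷ zs ++ [ u ])
        closing arc ε         = [] , arc ∷ [-]
        closing arc (arc′ ◅ s) = Product.map (_ ∷_) (arc ∷_) (closing arc′ s)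

    isAntichain⇒Unique : ∀ {xs} → IsAntichain G xs → Unique xs
    isAntichain⇒Unique (_ , pairs) = AllPairs.map (λ { (¬xy , _) refl → ¬xy ε }) pairs

    isAntichain? : Decidable (IsAntichain G)
    isAntichain? xs = All.all? Vertex? xs ×-dec
      AllPairs.allPairs? (λ x y → ¬? (reaches? Arc? x y) ×-dec ¬? (reaches? Arc? y x)) xs

    maximumAntichain : ∃ (IsMaximumAntichain G)
    maximumAntichain = longest isAntichain? isAntichain⇒Unique ([] , [] , [])

    shortestPathOfLength? : ∀ m → Dec (∃ λ xs → IsShortestPath G xs × numArcs G xs ≡ m)
    shortestPathOfLength? m = anyUnique? (λ xs → isShortestPath? xs ×-dec (numArcs G xs ℕ.≟ m))
                                         (isPath⇒Unique ∘ proj₁ ∘ proj₁)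

    longestShortestPath : ∃ Vertex → ∃ (IsLongestShortestPath G)
    longestShortestPath (x , v) =
      let xs , s , max = longest isShortestPath? (isPath⇒Unique ∘ proj₁)
            ([ x ] , ((λ ()) , v ∷ [] , [-] , [] ∷ []) , λ _ _ _ _ → z≤n)
      in xs , s , λ ys t → ℕ.∸-monoˡ-≤ 1 (max ys t)

-- Pointwise related lists and odd-indexed sublists.

Pointwise-All : {R : REL A B ℓ} {P : Pred B p} {xs : List A} {ys : List B} →
                Pointwise R xs ys → All P ys → Pointwise (λ x y → R x y × P y) xs ys
Pointwise-All []       []         = []
Pointwise-All (r ∷ rs) (py ∷ pys) = (r , py) ∷ Pointwise-All rs pys

AllPairs-Pointwise : {R : REL A B ℓ} {P : Rel B p} {Q : Rel A q} {xs : List A} {ys : List B} →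
                     (∀ {x x′ y y′} → R x y → R x′ y′ → P y y′ → Q x x′) →
                     Pointwise R xs ys → AllPairs P ys → AllPairs Q xs
AllPairs-Pointwise {R = R} {P} {Q} f []       []       = []
AllPairs-Pointwise {R = R} {P} {Q} f (r ∷ rs) (p ∷ ps) = all rs p ∷ AllPairs-Pointwise f rs ps
  where
  all : ∀ {xs ys} → Pointwise R xs ys → All (P _) ys → All (Q _) xs
  all []       []       = []
  all (s ∷ rs) (p ∷ ps) = f r s p ∷ all rs ps

Pointwise-choice : {R : REL A B ℓ} {ys : List B} → All (λ y → ∃ λ x → R x y) ys → ∃ λ xs → Pointwise R xs ys
Pointwise-choice []             = [] , []
Pointwise-choice ((x , r) ∷ rs) = Product.map (x ∷_) (r ∷_) (Pointwise-choice rs)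

Pointwise-∈ˡ : {R : REL A B ℓ} {xs : List A} {ys : List B} → Pointwise R xs ys →
               ∀ {x} → x ∈ˡ xs → ∃ λ y → y ∈ˡ ys × R x y
Pointwise-∈ˡ (r ∷ _)  (here refl) = _ , here refl , r
Pointwise-∈ˡ (_ ∷ rs) (there x∈)  = Product.map₂ (Product.map₁ there) (Pointwise-∈ˡ rs x∈)

-- `Z` does not mention the pair, so one failing pair settles the alternative for the whole list.
AllPairs-⊎ : {P : Rel A p} {Q : Rel A q} {Z : Set r} {xs : List A} →
             (∀ {x y} → P x y → Q x y ⊎ Z) → AllPairs P xs → AllPairs Q xs ⊎ Z
AllPairs-⊎ f []       = inj₁ []
AllPairs-⊎ {P = P} {Q} {Z} f (p ∷ ps) with all p | AllPairs-⊎ f ps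
  where
  all : ∀ {x xs} → All (P x) xs → All (Q x) xs ⊎ Z
  all []       = inj₁ []
  all (p ∷ ps) with f p | all ps
  ... | inj₂ z | _      = inj₂ z
  ... | inj₁ _ | inj₂ z = inj₂ z
  ... | inj₁ q | inj₁ qs = inj₁ (q ∷ qs)
... | inj₂ z | _       = inj₂ z
... | inj₁ _ | inj₂ z  = inj₂ z
... | inj₁ q | inj₁ qs = inj₁ (q ∷ qs)

length≤2*oddIndexed : (xs : List A) → length xs ℕ.≤ 2 ℕ.* length (oddIndexed xs)
length≤2*oddIndexed []           = z≤n
length≤2*oddIndexed (x ∷ [])     = s≤s z≤n
length≤2*oddIndexed (x ∷ y ∷ xs) =
  subst (2 ℕ.+ length xs ℕ.≤_) (sym (ℕ.*-suc 2 (length (oddIndexed xs)))) (s≤s (s≤s (length≤2*oddIndexed xs)))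

oddIndexed-⊆ : (xs : List A) {x : A} → x ∈ˡ oddIndexed xs → x ∈ˡ xs
oddIndexed-⊆ (x ∷ [])     x∈          = x∈
oddIndexed-⊆ (x ∷ y ∷ xs) (here refl) = here refl
oddIndexed-⊆ (x ∷ y ∷ xs) (there x∈)  = there (there (oddIndexed-⊆ xs x∈))

All-oddIndexed : {P : Pred A p} {xs : List A} → All P xs → All P (oddIndexed xs)
All-oddIndexed ps = All.tabulate λ x∈ → All.lookup ps (oddIndexed-⊆ _ x∈)

-- `oddIndexed` counts from 1 and `Fin` from 0, which is why odd indices become even positions.
oddIndexed-lookup : (xs : List A) {x : A} → x ∈ˡ oddIndexed xs → ∃₂ λ i m → x ≡ lookup xs i × toℕ i ≡ 2 ℕ.* m
oddIndexed-lookup (x ∷ [])     (here refl) = zero , 0 , refl , refl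
oddIndexed-lookup (x ∷ y ∷ xs) (here refl) = zero , 0 , refl , refl
oddIndexed-lookup (x ∷ y ∷ xs) (there x∈)  =
  let i , m , eq , par = oddIndexed-lookup xs x∈
  in suc (suc i) , ℕ.suc m , eq , trans (cong (2 ℕ.+_) par) (sym (ℕ.*-suc 2 m))

-- Two odd-indexed entries always have an entry between them. The full decomposition of `xs` is
-- passed on so that an argument about the whole list, such as minimality of a path, can be applied
-- to it.
AllPairs-oddIndexed : {R : Rel A ℓ} (xs : List A) →
  (∀ ps {x qs y rs} → qs ≢ [] → xs ≡ ps ++ x ∷ qs ++ y ∷ rs → R x y) → AllPairs R (oddIndexed xs)
AllPairs-oddIndexed []           h = []
AllPairs-oddIndexed (x ∷ [])     h = [] ∷ []
AllPairs-oddIndexed (x ∷ y ∷ xs) h =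
  All.tabulate (λ z∈ → let qs , rs , eq = ∈-∃++ (oddIndexed-⊆ xs z∈) in
    h [] {qs = y ∷ qs} (λ ()) (cong (λ e → x ∷ y ∷ e) eq)) ∷
  AllPairs-oddIndexed xs (λ ps ne eq → h (x ∷ y ∷ ps) ne (cong (λ e → x ∷ y ∷ e) eq))

Unique-oddIndexed : (xs : List A) → Unique xs → Unique (oddIndexed xs)
Unique-oddIndexed xs u = AllPairs-oddIndexed xs λ where
  ps {x} {qs} ne refl → All.head (All.++⁻ʳ qs (AllPairs.head (AllPairs-++⁻ʳ ps u)))

-- Finite subsets as bit vectors and as lists.

subset : {P : Pred (Fin n) p} → Decidable P → Subset n
subset P? = Vec.tabulate (does ∘ P?)

∈-subset⇔ : {P : Pred (Fin n) p} (P? : Decidable P) → ∀ x → x ∈ subset P? ⇔ P x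
∈-subset⇔ {P = P} P? x = mk⇔
  (λ x∈ → to (P? x) (trans (sym (Vec.lookup∘tabulate _ x)) (Vec.[]=⇒lookup x∈)))
  (λ px → Vec.lookup⇒[]= x _ (trans (Vec.lookup∘tabulate _ x) (dec-true (P? x) px)))
  where
  to : (d : Dec (P x)) → does d ≡ true → P x
  to (yes px) _ = px

subsets : ∀ n → List (Subset n)
subsets ℕ.zero    = [ [] ]
subsets (ℕ.suc n) = map (inside ∷_) (subsets n) ++ map (outside ∷_) (subsets n)

∈-subsets : (S : Subset n) → S ∈ˡ subsets n
∈-subsets []            = here refl
∈-subsets (true  ∷ S) = ∈-++⁺ˡ (∈-map⁺ (inside ∷_) (∈-subsets S))
∈-subsets {ℕ.suc n} (false ∷ S) = ∈-++⁺ʳ (map (inside ∷_) (subsets n)) (∈-map⁺ (outside ∷_) (∈-subsets S))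

_≟ˢ_ : DecidableEquality (Subset n)
_≟ˢ_ = Vec.≡-dec _≟ᵇ_

elements : Subset n → List (Fin n)
elements []          = []
elements (true  ∷ S) = zero ∷ map suc (elements S)
elements (false ∷ S) = map suc (elements S)

length-elements : (S : Subset n) → length (elements S) ≡ ∣ S ∣
length-elements []          = refl
length-elements (true  ∷ S) = cong ℕ.suc (trans (length-map suc (elements S)) (length-elements S))
length-elements (false ∷ S) = trans (length-map suc (elements S)) (length-elements S)

elements-unique : (S : Subset n) → Unique (elements S)
elements-unique []          = []
elements-unique (true  ∷ S) = All.map⁺ (All.tabulate λ _ ()) ∷
                              AllPairs.map⁺ (AllPairs.map (_∘ Fin.suc-injective) (elements-unique S))
elements-unique (false ∷ S) = AllPairs.map⁺ (AllPairs.map (_∘ Fin.suc-injective) (elements-unique S))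

elements-∈ : (S : Subset n) → All (_∈ S) (elements S)
elements-∈ []          = []
elements-∈ (true  ∷ S) = here ∷ All.map⁺ (All.map there (elements-∈ S))
elements-∈ (false ∷ S) = All.map⁺ (All.map there (elements-∈ S))

x∈p─q⇒x∉q : (p q : Subset n) {x : Fin n} → x ∈ p ─ q → x ∉ q
x∈p─q⇒x∉q (_ ∷ p) (true  ∷ q) (there x∈) (there x∈q) = x∈p─q⇒x∉q p q x∈ x∈q
x∈p─q⇒x∉q (_ ∷ p) (false ∷ q) (there x∈) (there x∈q) = x∈p─q⇒x∉q p q x∈ x∈q

∣⁅x⁆∪p∣≡1+∣p∣ : (x : Fin n) (p : Subset n) → x ∉ p → ∣ ⁅ x ⁆ ∪ p ∣ ≡ ℕ.suc ∣ p ∣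
∣⁅x⁆∪p∣≡1+∣p∣ zero    (true  ∷ p) x∉ = contradiction here x∉
∣⁅x⁆∪p∣≡1+∣p∣ zero    (false ∷ p) x∉ = cong (ℕ.suc ∘ ∣_∣) (Subset.∪-identityˡ p)
∣⁅x⁆∪p∣≡1+∣p∣ (suc x) (true  ∷ p) x∉ = cong ℕ.suc (∣⁅x⁆∪p∣≡1+∣p∣ x p (x∉ ∘ there))
∣⁅x⁆∪p∣≡1+∣p∣ (suc x) (false ∷ p) x∉ = ∣⁅x⁆∪p∣≡1+∣p∣ x p (x∉ ∘ there)

∈-⋃⁅⁆⁻ : (xs : List (Fin n)) {x : Fin n} → x ∈ ⋃ (map ⁅_⁆ xs) → x ∈ˡ xs
∈-⋃⁅⁆⁻ []       x∈ = contradiction x∈ Subset.∉⊥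
∈-⋃⁅⁆⁻ (y ∷ xs) x∈ with Subset.x∈p∪q⁻ ⁅ y ⁆ _ x∈
... | inj₁ x∈y = here (Subset.x∈⁅y⁆⇒x≡y y x∈y)
... | inj₂ x∈⋃ = there (∈-⋃⁅⁆⁻ xs x∈⋃)

∣⋃⁅⁆∣≡length : (xs : List (Fin n)) → Unique xs → ∣ ⋃ (map ⁅_⁆ xs) ∣ ≡ length xs
∣⋃⁅⁆∣≡length {n} []       []       = Subset.∣⊥∣≡0 n
∣⋃⁅⁆∣≡length     (x ∷ xs) (x∉ ∷ u) = trans
  (∣⁅x⁆∪p∣≡1+∣p∣ x _ λ x∈ → All.lookup x∉ (∈-⋃⁅⁆⁻ xs x∈) refl)
  (cong ℕ.suc (∣⋃⁅⁆∣≡length xs u))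

-- Strongly connected components and the condensation.

module Condensation (G : Digraph (Fin n) p q)
                    (Vertex? : Decidable (Digraph.Vertex G)) (Arc? : Decidable₂ (Digraph.Arc G))
                    (Arc⇒Vertex : ∀ {x y} → Digraph.Arc G x y → Digraph.Vertex G x × Digraph.Vertex G y) where

  open Digraph G

  private
    module G  = FiniteDigraph Fin._≟_ (allFin n) ∈-allFin G
    Gc = condensation G
    module Gc = Digraph Gc
    module Gcᶠ = FiniteDigraph _≟ˢ_ (subsets n) ∈-subsets Gc
    SCC = IsStronglyConnectedComponent G

  private
    inComponent? : ∀ u → Decidable (λ v → Vertex v × Reaches G u v × Reaches G v u)
    inComponent? u v = Vertex? v ×-dec G.reaches? Arc? u v ×-dec G.reaches? Arc? v u

  component : Fin n → Subset n
  component u = subset (inComponent? u)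

  component-isSCC : ∀ {u} → Vertex u → SCC (component u)
  component-isSCC {u} v = u , v , ∈-subset⇔ (inComponent? u)

  ∈-component : ∀ {u} → Vertex u → u ∈ component u
  ∈-component {u} v = Equivalence.from (∈-subset⇔ (inComponent? u) u) (v , ε , ε)

  isSCC? : Decidable SCC
  isSCC? A = Fin.any? λ u → Vertex? u ×-dec Fin.all? λ v →
    map′ (λ (f , g) → mk⇔ f g) (λ e → Equivalence.to e , Equivalence.from e)
      ((v Subset.∈? A →-dec inComponent? u v) ×-dec (inComponent? u v →-dec v Subset.∈? A))

  condensationArc? : Decidable₂ Gc.Arc
  condensationArc? A B = isSCC? A ×-dec isSCC? B ×-dec ¬? (A ≟ˢ B) ×-dec
    Fin.any? λ i → Fin.any? λ j → i Subset.∈? A ×-dec j Subset.∈? B ×-dec Arc? i j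

  condensationArc⇒Vertex : ∀ {A B} → Gc.Arc A B → SCC A × SCC B
  condensationArc⇒Vertex (a , b , _) = a , b

  SCC-nonempty : ∀ {A} → SCC A → ∃ (_∈ A)
  SCC-nonempty (u , v , h) = u , Equivalence.from (h u) (v , ε , ε)

  SCC-Vertex : ∀ {A u} → SCC A → u ∈ A → Vertex u
  SCC-Vertex (_ , _ , h) u∈A = proj₁ (Equivalence.to (h _) u∈A)

  SCC-reaches : ∀ {A u v} → SCC A → u ∈ A → v ∈ A → Reaches G u v
  SCC-reaches (w , _ , h) u∈A v∈A =
    proj₂ (proj₂ (Equivalence.to (h _) u∈A)) ◅◅ proj₁ (proj₂ (Equivalence.to (h _) v∈A))

  SCC-≡ : ∀ {A B u v} → SCC A → SCC B → u ∈ A → v ∈ B → Reaches G u v → Reaches G v u → A ≡ B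
  SCC-≡ a b u∈A v∈B uv vu = Subset.⊆-antisym (half a b u∈A v∈B uv vu) (half b a v∈B u∈A vu uv)
    where
    half : ∀ {A B u v} → SCC A → SCC B → u ∈ A → v ∈ B → Reaches G u v → Reaches G v u →
           ∀ {x} → x ∈ A → x ∈ B
    half a b@(w , _ , h) u∈A v∈B uv vu x∈A = Equivalence.from (h _)
      ( SCC-Vertex a x∈A
      , proj₁ (proj₂ (Equivalence.to (h _) v∈B)) ◅◅ vu ◅◅ SCC-reaches a u∈A x∈A
      , SCC-reaches a x∈A u∈A ◅◅ uv ◅◅ proj₂ (proj₂ (Equivalence.to (h _) v∈B)) )

  -- Within a component, strong connectivity leads from the point where one arc enters to the point
  -- where the next one leaves.
  condensation-reaches⁻ : ∀ {A B u v} → SCC A → u ∈ A → v ∈ B → Reaches Gc A B → Reaches G u v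
  condensation-reaches⁻ a u∈A v∈B ε = SCC-reaches a u∈A v∈B
  condensation-reaches⁻ a u∈A v∈B ((_ , c , _ , i , j , i∈A , j∈C , arc) ◅ s) =
    SCC-reaches a u∈A i∈A ◅◅ arc ◅ condensation-reaches⁻ c j∈C v∈B s

  condensation-reaches⁺ : ∀ {u v} → Vertex u → Reaches G u v → Reaches Gc (component u) (component v)
  condensation-reaches⁺ v ε = ε
  condensation-reaches⁺ {u} v (_◅_ {j = w} arc s) with component u ≟ˢ component w
  ... | yes eq = subst (λ A → Reaches Gc A _) (sym eq) (condensation-reaches⁺ (proj₂ (Arc⇒Vertex arc)) s)
  ... | no  ne = (component-isSCC v , component-isSCC w∈G , ne , u , w , ∈-component v , ∈-component w∈G , arc)
                 ◅ condensation-reaches⁺ w∈G s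
    where w∈G = proj₂ (Arc⇒Vertex arc)

  -- Such an arc would make its two ends mutually reachable in `G`, and the two components would
  -- coincide.
  condensation-acyclic : ∀ {A B} → Reaches Gc A B → ¬ Gc.Arc B A
  condensation-acyclic s (b , a , B≢A , i , j , i∈B , j∈A , arc) =
    B≢A (SCC-≡ b a i∈B j∈A (arc ◅ ε) (condensation-reaches⁻ a j∈A i∈B s))

  -- The common ground of antichains and shortest paths: components on a path do reach one another,
  -- so unreachability would be too much to ask.
  Separated : Subset n → Subset n → Set _
  Separated A B = A ≢ B × ¬ Gc.Arc A B × ¬ Gc.Arc B A

  Apart : Fin n → Fin n → Set _
  Apart u v = u ≢ v × ¬ Arc u v × ¬ Arc v u

  separated⇒apart : ∀ {I Bs} → Pointwise _∈_ I Bs → All SCC Bs → AllPairs Separated Bs → AllPairs Apart I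
  separated⇒apart ps sccs seps = AllPairs-Pointwise
    (λ { (u∈A , a) (v∈B , b) (A≢B , ¬AB , ¬BA) →
         (λ { refl → A≢B (SCC-≡ a b u∈A v∈B ε ε) }) ,
         (λ arc → ¬AB (a , b , A≢B , _ , _ , u∈A , v∈B , arc)) ,
         (λ arc → ¬BA (b , a , A≢B ∘ sym , _ , _ , v∈B , u∈A , arc)) })
    (Pointwise-All ps sccs) seps

  antichain⇒separated : ∀ {M} → IsAntichain Gc M → AllPairs Separated M
  antichain⇒separated (_ , pairs) =
    AllPairs.map (λ (¬AB , ¬BA) → (λ { refl → ¬AB ε }) , (λ arc → ¬AB (arc ◅ ε)) , λ arc → ¬BA (arc ◅ ε)) pairs

  private
    linked⇒reaches : ∀ {A} qs {B rs} → Linked Gc.Arc (A ∷ qs ++ B ∷ rs) → Reaches Gc A B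
    linked⇒reaches []       (arc ∷ _)  = arc ◅ ε
    linked⇒reaches (_ ∷ qs) (arc ∷ ls) = arc ◅ linked⇒reaches qs ls

  -- The two directions fail for different reasons: a forward arc would be a shortcut, a backward
  -- arc would close a cycle in the condensation.
  shortestPath⇒separated : ∀ {L} → IsShortestPath Gc L → AllPairs Separated (oddIndexed L)
  shortestPath⇒separated {L} s@((_ , _ , ls , u) , _) = AllPairs-oddIndexed L λ where
    ps {A} {qs} {B} ne refl →
      All.head (All.++⁻ʳ qs (AllPairs.head (AllPairs-++⁻ʳ ps u))) ,
      Gcᶠ.shortest⇒no-shortcut isSCC? condensationArc? condensationArc⇒Vertex ps ne s ,
      condensation-acyclic (linked⇒reaches qs (Linked-++⁻ʳ ps ls))

-- Arithmetic in ordered fields.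

module OrderedFieldProperties {c ℓ₁ ℓ₂} (F : OrderedField c ℓ₁ ℓ₂) where
  open OrderedField F renaming (refl to ≈-refl; sym to ≈-sym; trans to ≈-trans) hiding (zero)
  open DecTotalOrder decTotalOrder public using (_≤?_; totalOrder)
    renaming (refl to ≤-refl; trans to ≤-trans; total to ≤-total; reflexive to ≤-reflexive; _≟_ to _≈?_)
  open DecTotalOrderProperties decTotalOrder public using (≰⇒>; <⇒≱; ≮⇒≥; ≤∧≉⇒<)
  open Mult semiring public using (×-homo-+; ×-congʳ; ×-assocˡ; ×-assoc-*) renaming (_×_ to _·_)
  open RingProperties ring using (-‿distribˡ-*; -‿involutive)

  +-mono-≤ : ∀ {w x y z} → w ≤ x → y ≤ z → w + y ≤ x + z
  +-mono-≤ {w} {x} {y} {z} w≤x y≤z = ≤-trans (+-monoˡ-≤ y w≤x)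
    (≤-trans (≤-reflexive (+-comm x y)) (≤-trans (+-monoˡ-≤ x y≤z) (≤-reflexive (+-comm z x))))

  private
    x+y-y≈x : ∀ x y → (x + y) + - y ≈ x
    x+y-y≈x x y = ≈-trans (+-assoc x y (- y)) (≈-trans (+-congˡ (-‿inverseʳ y)) (+-identityʳ x))

  +-cancelʳ-≤ : ∀ {x y} z → x + z ≤ y + z → x ≤ y
  +-cancelʳ-≤ {x} {y} z h = ≤-trans (≤-reflexive (≈-sym (x+y-y≈x x z)))
    (≤-trans (+-monoˡ-≤ (- z) h) (≤-reflexive (x+y-y≈x y z)))

  +-mono-<-≤ : ∀ {w x y z} → w < x → y ≤ z → w + y < x + z
  +-mono-<-≤ {w} {x} {y} {z} w<x y≤z = ≰⇒> λ h →
    <⇒≱ w<x (+-cancelʳ-≤ z (≤-trans h (+-mono-≤ ≤-refl y≤z)))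

  <-≤-trans : ∀ {x y z} → x < y → y ≤ z → x < z
  <-≤-trans x<y y≤z = ≰⇒> λ z≤x → <⇒≱ x<y (≤-trans y≤z z≤x)

  ≤-<-trans : ∀ {x y z} → x ≤ y → y < z → x < z
  ≤-<-trans x≤y y<z = ≰⇒> λ z≤x → <⇒≱ y<z (≤-trans z≤x x≤y)

  0≤1 : 0# ≤ 1#
  0≤1 with ≤-total 0# 1#
  ... | inj₁ h = h
  ... | inj₂ h = ≤-trans (*-nonNegative 0≤-1 0≤-1) (≤-reflexive
          (≈-trans (≈-sym (-‿distribˡ-* 1# (- 1#))) (≈-trans (-‿cong (*-identityˡ (- 1#))) (-‿involutive 1#))))
    where
    0≤-1 : 0# ≤ - 1#
    0≤-1 = ≤-trans (≤-reflexive (≈-sym (-‿inverseʳ 1#))) (≤-trans (+-monoˡ-≤ (- 1#) h) (≤-reflexive (+-identityˡ (- 1#))))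

  ·-nonNegative : ∀ m {x} → 0# ≤ x → 0# ≤ m · x
  ·-nonNegative ℕ.zero    h = ≤-refl
  ·-nonNegative (ℕ.suc m) h = ≤-trans (≤-reflexive (≈-sym (+-identityˡ 0#))) (+-mono-≤ h (·-nonNegative m h))

  ·-zeroʳ : ∀ m → m · 0# ≈ 0#
  ·-zeroʳ ℕ.zero    = ≈-refl
  ·-zeroʳ (ℕ.suc m) = ≈-trans (+-identityˡ _) (·-zeroʳ m)

  ·-monoʳ-≤ : ∀ m {x y} → x ≤ y → m · x ≤ m · y
  ·-monoʳ-≤ ℕ.zero    h = ≤-refl
  ·-monoʳ-≤ (ℕ.suc m) h = +-mono-≤ h (·-monoʳ-≤ m h)

  ·-monoʳ-< : ∀ m .{{_ : ℕ.NonZero m}} {x y} → x < y → m · x < m · y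
  ·-monoʳ-< (ℕ.suc m) h = +-mono-<-≤ h (·-monoʳ-≤ m (proj₁ h))

  -- Turns inequalities between distances into inequalities between numbers of arcs.
  ·-cancelʳ-≤ : ∀ m n {x} → 0# < x → m · x ≤ n · x → m ℕ.≤ n
  ·-cancelʳ-≤ m n {x} 0<x h = ℕ.≮⇒≥ λ n<m → <⇒≱ (strict (ℕ.m≤n⇒∃[o]m+o≡n n<m)) h
    where
    strict : (∃ λ o → ℕ.suc n ℕ.+ o ≡ m) → n · x < m · x
    strict (e , refl) = <-≤-trans
      (≤-<-trans (≤-reflexive (≈-sym (+-identityˡ (n · x)))) (+-mono-<-≤ 0<x (≤-refl {n · x})))
      (≤-trans (≤-reflexive (≈-sym (+-identityʳ _)))
        (≤-trans (+-mono-≤ ≤-refl (·-nonNegative e (proj₁ 0<x))) (≤-reflexive (≈-sym (×-homo-+ x (ℕ.suc n) e)))))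

  fromℕ≉0 : ∀ m .{{_ : ℕ.NonZero m}} → ¬ fromℕ m ≈ 0#
  fromℕ≉0 (ℕ.suc m) h = <⇒≱ (≤∧≉⇒< 0≤1 0≉1)
    (≤-trans (≤-reflexive (≈-sym (+-identityʳ 1#)))
      (≤-trans (+-mono-≤ ≤-refl (·-nonNegative m 0≤1)) (≤-reflexive h)))

  ·-/-cancel : ∀ m .{{_ : ℕ.NonZero m}} x → m · (x / fromℕ m) ≈ x
  ·-/-cancel m x = begin
    m · (x / fromℕ m)               ≈⟨ ×-congʳ m (*-identityˡ _) ⟨
    m · (1# * (x / fromℕ m))        ≈⟨ ×-assoc-* m 1# _ ⟨
    fromℕ m * (x / fromℕ m)         ≈⟨ *-congˡ (*-comm x _) ⟩
    fromℕ m * (fromℕ m ⁻¹ * x)      ≈⟨ *-assoc _ _ _ ⟨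
    fromℕ m * fromℕ m ⁻¹ * x        ≈⟨ *-congʳ (*-inverseʳ _ (fromℕ≉0 m)) ⟩
    1# * x                          ≈⟨ *-identityˡ x ⟩
    x                               ∎
    where open ≈-Reasoning setoid

  /-positive : ∀ m .{{_ : ℕ.NonZero m}} {x} → 0# < x → 0# < x / fromℕ m
  /-positive m {x} 0<x = ≰⇒> λ h → <⇒≱ 0<x (≤-trans (≤-reflexive (≈-sym (·-/-cancel m x)))
    (≤-trans (·-monoʳ-≤ m h) (≤-reflexive (·-zeroʳ m))))

  -- The quotients are compared after multiplication by `j * m`, where `·-/-cancel` removes both
  -- divisions. Taking `j` to be 3 and `m` to be 2k produces the denominator 6k.
  /-mono-≤-· : ∀ j m .{{_ : ℕ.NonZero m}} .{{_ : ℕ.NonZero (j ℕ.* m)}} {x y} →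
               x ≤ j · y → x / fromℕ (j ℕ.* m) ≤ y / fromℕ m
  /-mono-≤-· j m {x} {y} x≤jy = ≮⇒≥ λ lt → <⇒≱ (·-monoʳ-< (j ℕ.* m) lt)
    (≤-trans (≤-reflexive (·-/-cancel (j ℕ.* m) x)) (≤-trans x≤jy (≤-reflexive
      (≈-trans (×-congʳ j (≈-sym (·-/-cancel m y))) (×-assocˡ _ j m)))))

  -- The largest of three summands alone accounts for a third of the sum.
  ≤-sum₃⇒≤-3· : ∀ {s x y z} → s ≤ x + (y + z) → s ≤ 3 · x ⊎ s ≤ 3 · y ⊎ s ≤ 3 · z
  ≤-sum₃⇒≤-3· {s} {x} {y} {z} h with ≤-total x y
  ≤-sum₃⇒≤-3· {s} {x} {y} {z} h | inj₁ x≤y with ≤-total y z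
  ... | inj₁ y≤z = inj₂ (inj₂ (≤-trans h (+-mono-≤ (≤-trans x≤y y≤z) (+-mono-≤ y≤z (≤-reflexive (≈-sym (+-identityʳ z)))))))
  ... | inj₂ z≤y = inj₂ (inj₁ (≤-trans h (+-mono-≤ x≤y (+-mono-≤ ≤-refl (≤-trans z≤y (≤-reflexive (≈-sym (+-identityʳ y))))))))
  ≤-sum₃⇒≤-3· {s} {x} {y} {z} h | inj₂ y≤x with ≤-total x z
  ... | inj₁ x≤z = inj₂ (inj₂ (≤-trans h (+-mono-≤ x≤z (+-mono-≤ (≤-trans y≤x x≤z) (≤-reflexive (≈-sym (+-identityʳ z)))))))
  ... | inj₂ z≤x = inj₁ (≤-trans h (+-mono-≤ ≤-refl (+-mono-≤ y≤x (≤-trans z≤x (≤-reflexive (≈-sym (+-identityʳ x)))))))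

-- Diversity, clustering and greedy selection.

module Metric {c ℓ₁ ℓ₂} {F : OrderedField c ℓ₁ ℓ₂} {n : ℕ} (X : AsymmetricPseudometric F n) where
  open OrderedField F renaming (refl to ≈-refl; sym to ≈-sym; trans to ≈-trans) hiding (zero)
  open OrderedFieldProperties F
  open AsymmetricPseudometric X
  open MinOp (Min.minOperator totalOrder) using (x⊓y≤x; x⊓y≤y; ⊓-glb)
  open MaxOp (Max.maxOperator totalOrder) using (x≤x⊔y; x≤y⊔x; ⊔-lub)
  open Extrema totalOrder using (argmax; argmin; argmax-sel; argmin-sel; f[xs]≤f[argmax]; f[argmin]≤f[xs])
  open Dec∈ (Fin._≟_ {n}) using () renaming (_∈?_ to _∈ˡ?_)

  dmax<⇒< : ∀ {u v r} → dmax X u v < r → d u v < r × d v u < r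
  dmax<⇒< {u} {v} lt = ≤-<-trans (x≤x⊔y (d u v) (d v u)) lt , ≤-<-trans (x≤y⊔x (d u v) (d v u)) lt

  dmax-comm-≤ : ∀ u v → dmax X u v ≤ dmax X v u
  dmax-comm-≤ u v = ⊔-lub (x≤y⊔x (d v u) (d u v)) (x≤x⊔y (d v u) (d u v))

  _<?_ : ∀ x y → Dec (x < y)
  x <? y = (x ≤? y) ×-dec ¬? (x ≈? y)

  module _ {S : Subset n} where

    private
      DistinctPair : Fin n × Fin n → Set
      DistinctPair (u , v) = u ∈ S × v ∈ S × u ≢ v

      distinctPair? : Decidable DistinctPair
      distinctPair? (u , v) = u Subset.∈? S ×-dec v Subset.∈? S ×-dec ¬? (u Fin.≟ v)

      pairs : List (Fin n × Fin n)
      pairs = filter distinctPair? (cartesianProduct (allFin n) (allFin n))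

      dist : Fin n × Fin n → Carrier
      dist (u , v) = d u v

      closest : (e : Fin n × Fin n) → DistinctPair e → ∃ (IsDiv X S)
      closest e pe = dist m , (proj₁ m , proj₂ m , proj₁ pm , proj₁ (proj₂ pm) , proj₂ (proj₂ pm) , ≈-refl) ,
        λ u v u∈S v∈S u≢v → All.lookup (f[argmin]≤f[xs] e pairs)
          (∈-filter⁺ distinctPair? (∈-cartesianProduct⁺ (∈-allFin u) (∈-allFin v)) (u∈S , v∈S , u≢v))
        where
        m = argmin dist e pairs
        pm : DistinctPair m
        pm with argmin-sel dist e pairs
        ... | inj₁ eq = subst DistinctPair (sym eq) pe
        ... | inj₂ m∈ = proj₂ (∈-filter⁻ distinctPair? {xs = cartesianProduct (allFin n) (allFin n)} m∈)

    div-exists : 2 ℕ.≤ ∣ S ∣ → ∃ (IsDiv X S)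
    div-exists 2≤ = first-two (elements S) (elements-∈ S) (elements-unique S)
                              (subst (2 ℕ.≤_) (sym (length-elements S)) 2≤)
      where
      first-two : (xs : List (Fin n)) → All (_∈ S) xs → Unique xs → 2 ℕ.≤ length xs → ∃ (IsDiv X S)
      first-two (u ∷ v ∷ _) (u∈ ∷ v∈ ∷ _) ((u≢v ∷ _) ∷ _) _ = closest (u , v) (u∈ , v∈ , u≢v)
      first-two (_ ∷ []) _ _ (s≤s ())

  div-greatest : ∀ {S r s} → IsDiv X S r → (∀ u v → u ∈ S → v ∈ S → u ≢ v → s ≤ d u v) → s ≤ r
  div-greatest ((u , v , u∈S , v∈S , u≢v , eq) , _) lower =
    ≤-trans (lower u v u∈S v∈S u≢v) (≤-reflexive eq)

  cluster-⊆ : ∀ {R T U′} → ClusterLoop X R T U′ → ∀ {x} → x ∈ U′ → x ∈ T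
  cluster-⊆ (done _) x∈ = contradiction x∈ Subset.∉⊥
  cluster-⊆ {T = T} (mark c A c∈T _ loop) x∈ with Subset.x∈p∪q⁻ ⁅ c ⁆ _ x∈
  ... | inj₁ x∈c rewrite Subset.x∈⁅y⁆⇒x≡y c x∈c = c∈T
  ... | inj₂ x∈U = Subset.p─q⊆p T A (cluster-⊆ loop x∈U)

  private
    far-from-centre : ∀ {R x} {T A : Subset n} → (∀ v → v ∈ A ⇔ (v ∈ T × dmax X x v < R)) →
                      ∀ {v} → v ∈ T ─ A → R ≤ dmax X x v
    far-from-centre {T = T} {A} A⇔ v∈ = ≮⇒≥ λ lt →
      x∈p─q⇒x∉q T A v∈ (Equivalence.from (A⇔ _) (Subset.p─q⊆p T A v∈ , lt))

  -- The point that became a centre later was still unmarked after the marking around the earlier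
  -- one.
  cluster-separated : ∀ {R T U′} → ClusterLoop X R T U′ →
                      ∀ {x y} → x ∈ U′ → y ∈ U′ → x ≢ y → R ≤ dmax X x y
  cluster-separated (done _) x∈ _ _ = contradiction x∈ Subset.∉⊥
  cluster-separated (mark c A c∈T A⇔ loop) {x} {y} x∈ y∈ x≢y
    with Subset.x∈p∪q⁻ ⁅ c ⁆ _ x∈ | Subset.x∈p∪q⁻ ⁅ c ⁆ _ y∈
  ... | inj₁ x∈c | inj₁ y∈c =
    contradiction (trans (Subset.x∈⁅y⁆⇒x≡y c x∈c) (sym (Subset.x∈⁅y⁆⇒x≡y c y∈c))) x≢y
  ... | inj₁ x∈c | inj₂ y∈U rewrite Subset.x∈⁅y⁆⇒x≡y c x∈c = far-from-centre A⇔ (cluster-⊆ loop y∈U)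
  ... | inj₂ x∈U | inj₁ y∈c rewrite Subset.x∈⁅y⁆⇒x≡y c y∈c =
    ≤-trans (far-from-centre A⇔ (cluster-⊆ loop x∈U)) (dmax-comm-≤ c x)
  ... | inj₂ x∈U | inj₂ y∈U = cluster-separated loop x∈U y∈U x≢y

  cluster-covers : ∀ {R T U′} → ClusterLoop X R T U′ → ∀ {v} → v ∈ T → ∃ λ c → c ∈ U′ × dmax X c v < R
  cluster-covers (done empty) v∈T = contradiction (_ , v∈T) empty
  cluster-covers (mark c A c∈T A⇔ loop) {v} v∈T with v Subset.∈? A
  ... | yes v∈A = c , Subset.x∈p∪q⁺ (inj₁ (Subset.x∈⁅x⁆ c)) , proj₂ (Equivalence.to (A⇔ v) v∈A)
  ... | no  v∉A =
    let c′ , c′∈ , lt = cluster-covers loop (Subset.x∈p∧x∉q⇒x∈p─q v∈T v∉A)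
    in c′ , Subset.x∈p∪q⁺ (inj₂ c′∈) , lt

  -- Since `d c c` is 0 and `R` is positive, every centre marks itself, so the set of unmarked
  -- points shrinks in each round.
  cluster-exists : ∀ {R} → 0# < R → ∃ (Cluster X R)
  cluster-exists {R} 0<R = go full (<-wellFounded _)
    where
    go : ∀ T → Acc ℕ._<_ ∣ T ∣ → ∃ (ClusterLoop X R T)
    go T (acc rec) with Subset.nonempty? T
    ... | no  empty     = _ , done empty
    ... | yes (c , c∈T) = Product.map _ (mark c near c∈T (∈-subset⇔ near?))
                            (go (T ─ near) (rec (Subset.p∩q≢∅⇒∣p─q∣<∣p∣ T near (c , Subset.x∈p∩q⁺ (c∈T , c∈near)))))
      where
      near? : Decidable (λ v → v ∈ T × dmax X c v < R)
      near? v = v Subset.∈? T ×-dec dmax X c v <? R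
      near = subset near?
      c∈near : c ∈ near
      c∈near = Equivalence.from (∈-subset⇔ near? c)
        (c∈T , ≤-<-trans (⊔-lub (≤-reflexive (d-self c)) (≤-reflexive (d-self c))) 0<R)

  greedy-⊆ : ∀ {I s} → Greedy X I s → ∀ {u} → u ∈ˡ s → u ∈ˡ I
  greedy-⊆ (first u∈I)      (here refl) = u∈I
  greedy-⊆ (next g u∈I _ _) (here refl) = u∈I
  greedy-⊆ (next g _ _ _)   (there u∈)  = greedy-⊆ g u∈

  greedy-unique : ∀ {I s} → Greedy X I s → Unique s
  greedy-unique none            = []
  greedy-unique (first _)       = [] ∷ []
  greedy-unique (next {u} g _ u∉ _) =
    All.tabulate (λ v∈ u≡v → u∉ (subst (_∈ˡ _) (sym u≡v) v∈)) ∷ greedy-unique g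

  greedy-exists : ∀ {I} → Unique I → ∀ m → m ℕ.≤ length I → ∃ λ s → Greedy X I s × length s ≡ m
  greedy-exists         uI 0 _ = [] , none , refl
  greedy-exists {u ∷ _} uI 1 _ = [ u ] , first (here refl) , refl
  greedy-exists {I} uI (ℕ.suc (ℕ.suc m)) le with greedy-exists uI (ℕ.suc m) (ℕ.<⇒≤ le)
  ... | s ∷ ss , g , len = u ∷ s ∷ ss ,
        next g (proj₁ u∈) (proj₂ u∈) (λ v v∈I v∉ → All.lookup (f[xs]≤f[argmax] x₀ candidates)
                                         (∈-filter⁺ unselected? v∈I v∉)) ,
        cong ℕ.suc len
    where
    unselected? : Decidable (_∉ˡ s ∷ ss)
    unselected? v = ¬? (v ∈ˡ? s ∷ ss)
    candidates = filter unselected? I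
    start : ∃ λ x → x ∈ˡ I × x ∉ˡ s ∷ ss
    start = Unique∧length<⇒∃∉ Fin._≟_ uI (subst (ℕ._< length I) (sym len) le)
    x₀ = proj₁ start
    u = argmax (λ v → dminTo X v s ss) x₀ candidates
    u∈ : u ∈ˡ I × u ∉ˡ s ∷ ss
    u∈ with argmax-sel (λ v → dminTo X v s ss) x₀ candidates
    ... | inj₁ eq = subst (λ x → x ∈ˡ I × x ∉ˡ s ∷ ss) (sym eq) (proj₂ start)
    ... | inj₂ u∈c = ∈-filter⁻ unselected? u∈c

  dminTo-glb : ∀ {σ} u s ss → All (λ v → σ ≤ dmin X u v) (s ∷ ss) → σ ≤ dminTo X u s ss
  dminTo-glb u s []       (h ∷ [])  = h
  dminTo-glb u s (t ∷ ts) (h ∷ hs) = ⊓-glb h (dminTo-glb u t ts hs)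

  dminTo-≤ : ∀ u s ss {v} → v ∈ˡ s ∷ ss → dminTo X u s ss ≤ dmin X u v
  dminTo-≤ u s []       (here refl) = ≤-refl
  dminTo-≤ u s (t ∷ ts) (here refl) = x⊓y≤x _ _
  dminTo-≤ u s (t ∷ ts) (there v∈)  = ≤-trans (x⊓y≤y _ _) (dminTo-≤ u t ts v∈)

  dmin-comm-≤ : ∀ u v → dmin X u v ≤ dmin X v u
  dmin-comm-≤ u v = ⊓-glb (x⊓y≤y (d u v) (d v u)) (x⊓y≤x (d u v) (d v u))

  -- If the selected point conflicted with an earlier one, any point of I that
  -- remains unselected would be a better choice.
  greedy-avoids-pair : ∀ {σ I a b s} → Unique I →
    (∀ {u v} → u ∈ˡ I → v ∈ˡ I → u ≢ v → σ ≤ dmin X u v ⊎ (u ≡ a × v ≡ b) ⊎ (u ≡ b × v ≡ a)) →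
    Greedy X I s → length s ℕ.< length I → AllPairs (λ u v → σ ≤ dmin X u v) s
  greedy-avoids-pair uI H none      _ = []
  greedy-avoids-pair uI H (first _) _ = [] ∷ []
  greedy-avoids-pair {σ} {I} {a} {b} uI H (next {u} {s} {ss} g u∈I u∉ max) lt =
    All.tabulate far ∷ greedy-avoids-pair uI H g (ℕ.<-trans ℕ.≤-refl lt)
    where
    spare : ∃ λ v → v ∈ˡ I × v ∉ˡ u ∷ s ∷ ss
    spare = Unique∧length<⇒∃∉ Fin._≟_ uI lt
    v = proj₁ spare
    v∈I = proj₁ (proj₂ spare)
    v∉ = proj₂ (proj₂ spare)

    far-if-spare-far : All (λ t → σ ≤ dmin X v t) (s ∷ ss) → ∀ {w} → w ∈ˡ s ∷ ss → σ ≤ dmin X u w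
    far-if-spare-far hs w∈ = ≤-trans (dminTo-glb v s ss hs)
      (≤-trans (max v v∈I (v∉ ∘ there)) (dminTo-≤ u s ss w∈))

    -- In a conflict `u` and `w` are `a` and `b` in some order. The spare point is neither of them
    -- and hence belongs to no close pair.
    spare-far : ∀ {w} → w ∈ˡ s ∷ ss → (u ≡ a × w ≡ b) ⊎ (u ≡ b × w ≡ a) →
                ∀ {t} → t ∈ˡ s ∷ ss → σ ≤ dmin X v t
    spare-far w∈ conflict t∈ with H v∈I (greedy-⊆ g t∈) (λ { refl → v∉ (there t∈) })
    ... | inj₁ h = h
    ... | inj₂ (inj₁ (v≡a , _)) = contradiction
            (Sum.[ (λ (u≡a , _) → here (trans v≡a (sym u≡a)))
                 , (λ (_ , w≡a) → there (subst (_∈ˡ s ∷ ss) (trans w≡a (sym v≡a)) w∈)) ] conflict) v∉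
    ... | inj₂ (inj₂ (v≡b , _)) = contradiction
            (Sum.[ (λ (_ , w≡b) → there (subst (_∈ˡ s ∷ ss) (trans w≡b (sym v≡b)) w∈))
                 , (λ (u≡b , _) → here (trans v≡b (sym u≡b))) ] conflict) v∉

    far : ∀ {w} → w ∈ˡ s ∷ ss → σ ≤ dmin X u w
    far {w} w∈ with H u∈I (greedy-⊆ g w∈) (λ { refl → u∉ w∈ })
    ... | inj₁ h        = h
    ... | inj₂ conflict = far-if-spare-far (All.tabulate (spare-far w∈ conflict)) w∈

-- Extraction from a clustered set.

private
  2k≤1+2j⇒k≤j : ∀ k j → 2 ℕ.* k ℕ.≤ ℕ.suc (2 ℕ.* j) → k ℕ.≤ j
  2k≤1+2j⇒k≤j k j h = ℕ.≮⇒≥ λ j<k → ℕ.<⇒≱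
    (ℕ.≤-trans (ℕ.≤-reflexive (sym (ℕ.*-suc 2 j))) (ℕ.*-monoʳ-≤ 2 j<k)) h

module Extraction {c ℓ₁ ℓ₂} {F : OrderedField c ℓ₁ ℓ₂} {n : ℕ} (X : AsymmetricPseudometric F n)
                  (W : Subset n) (R : OrderedField.Carrier F) (k : ℕ) .{{_ : ℕ.NonZero (2 ℕ.* k)}}
                  (0<R : OrderedField._<_ F (OrderedField.0# F) R)
                  (separated : ∀ {x y} → x ∈ W → y ∈ W → x ≢ y → OrderedField._≤_ F R (dmax X x y)) where
  open OrderedField F renaming (refl to ≈-refl; sym to ≈-sym; trans to ≈-trans) hiding (zero)
  open OrderedFieldProperties F
  open AsymmetricPseudometric X
  open Metric X
  open MinOp (Min.minOperator totalOrder) using (x⊓y≤x; ⊓-glb)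
  open MaxOp (Max.maxOperator totalOrder) using (⊔-lub)

  σ : Carrier
  σ = R / fromℕ (2 ℕ.* k)

  0<σ : 0# < σ
  0<σ = /-positive (2 ℕ.* k) 0<R

  R≤m·σ⇒2k≤m : ∀ m → R ≤ m · σ → 2 ℕ.* k ℕ.≤ m
  R≤m·σ⇒2k≤m m h = ·-cancelʳ-≤ (2 ℕ.* k) m 0<σ (≤-trans (≤-reflexive (·-/-cancel (2 ℕ.* k) R)) h)

  private
    G = thresholdDigraph X W σ
    Gc = condensation G
    open Digraph G using (Arc)

    Arc? : Decidable₂ Arc
    Arc? i j = i Subset.∈? W ×-dec j Subset.∈? W ×-dec ¬? (i Fin.≟ j) ×-dec d i j <? σ

    Arc⇒Vertex : ∀ {x y} → Arc x y → x ∈ W × y ∈ W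
    Arc⇒Vertex (x∈ , y∈ , _) = x∈ , y∈

    Arc-irrefl : ∀ {x} → ¬ Arc x x
    Arc-irrefl (_ , _ , x≢x , _) = x≢x refl

    open Condensation G (Subset._∈? W) Arc? Arc⇒Vertex
    module Gᶠ = FiniteDigraph Fin._≟_ (allFin n) ∈-allFin G
    module Gcᶠ = FiniteDigraph _≟ˢ_ (subsets n) ∈-subsets Gc

    Far : Fin n → Fin n → Set ℓ₂
    Far u v = σ ≤ dmin X u v

    Far-sym : Symmetric Far
    Far-sym {u} {v} h = ≤-trans h (dmin-comm-≤ u v)

    apart⇒far : ∀ {u v} → u ∈ W → v ∈ W → Apart u v → Far u v
    apart⇒far u∈ v∈ (u≢v , ¬uv , ¬vu) = ⊓-glb
      (≮⇒≥ λ lt → ¬uv (u∈ , v∈ , u≢v , lt)) (≮⇒≥ λ lt → ¬vu (v∈ , u∈ , u≢v ∘ sym , lt))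

  walk-≤ : ∀ x xs {y} → Linked Arc (x ∷ xs) → last (x ∷ xs) ≡ just y → d x y ≤ length xs · σ
  walk-≤ x []       _        refl = ≤-reflexive (d-self x)
  walk-≤ x (z ∷ xs) {y} ((_ , _ , _ , lt) ∷ ls) eq =
    ≤-trans (triangle x y z) (+-mono-≤ (proj₁ lt) (walk-≤ z xs ls eq))

  -- Compare the first two vertices `x` and `y`. The arc between them is shorter than σ, so it is
  -- the way back, with one arc fewer than the cycle, that must span `R`. The bound `forth` is
  -- padded to the same number of arcs so that `dmax` can be bounded at once.
  cycle-long : ∀ {C} → IsCycle G C → 2 ℕ.* k ℕ.< length C
  cycle-long {_ ∷ []} (s≤s () , _)
  cycle-long {x ∷ y ∷ ys} (_ , x∈ ∷ y∈ ∷ _ , (x≢y ∷ _) ∷ _ , (_ , _ , _ , lt) ∷ ls) =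
    s≤s (R≤m·σ⇒2k≤m (ℕ.suc (length ys)) (≤-trans (separated x∈ y∈ x≢y) (⊔-lub forth back)))
    where
    forth : d x y ≤ ℕ.suc (length ys) · σ
    forth = ≤-trans (≤-trans (proj₁ lt) (≤-reflexive (≈-sym (+-identityʳ σ))))
                    (+-mono-≤ ≤-refl (·-nonNegative (length ys) (proj₁ 0<σ)))
    back : d y x ≤ ℕ.suc (length ys) · σ
    back = subst (λ m → d y x ≤ m · σ) (trans (length-++ ys) (ℕ.+-comm _ 1))
                 (walk-≤ y (ys ++ [ x ]) ls (last-++-∷ (y ∷ ys)))

  private
    at-first : ∀ {x : Fin n} {xs} j → toℕ j ≡ 0 → lookup (x ∷ xs) j ≡ x
    at-first zero _ = refl

    at-last : ∀ {x : Fin n} {xs} i → ℕ.suc (toℕ i) ≡ length (x ∷ xs) →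
              lookup (x ∷ xs) i ≡ lookup (x ∷ xs) (Fin.fromℕ (length xs))
    at-last {x} {xs} i eq = cong (lookup (x ∷ xs))
      (Fin.toℕ-injective (trans (ℕ.suc-injective eq) (sym (Fin.toℕ-fromℕ _))))

  -- Two even positions never differ by one, so odd-indexed vertices can be consecutive only across
  -- the wrap from the last vertex `z` to the first vertex `x`. Chordlessness handles every other
  -- pair.
  cycle-odd-far : ∀ {x xs} → IsChordlessCycle G (x ∷ xs) → ∀ {u v} →
    let C = x ∷ xs; z = lookup C (Fin.fromℕ (length xs)) in
    u ∈ˡ oddIndexed C → v ∈ˡ oddIndexed C → u ≢ v → Far u v ⊎ (u ≡ x × v ≡ z) ⊎ (u ≡ z × v ≡ x)
  cycle-odd-far {x} {xs} ((_ , vs , _) , chordless) {u} {v} u∈ v∈ u≢v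
    with i , l , u≡ , pi ← oddIndexed-lookup (x ∷ xs) u∈
       | j , m , v≡ , pj ← oddIndexed-lookup (x ∷ xs) v∈
    with wraps? i j | wraps? j i
    where
    Wraps : (i j : Fin (length (x ∷ xs))) → Set
    Wraps i j = ℕ.suc (toℕ i) ≡ length (x ∷ xs) × toℕ j ≡ 0
    wraps? : Decidable₂ Wraps
    wraps? i j = (ℕ.suc (toℕ i) ℕ.≟ length (x ∷ xs)) ×-dec (toℕ j ℕ.≟ 0)
  ... | yes (i-last , j-first) | _ = inj₂ (inj₂ (trans u≡ (at-last i i-last) , trans v≡ (at-first j j-first)))
  ... | no _ | yes (j-last , i-first) = inj₂ (inj₁ (trans u≡ (at-first i i-first) , trans v≡ (at-last j j-last)))
  ... | no ¬ij | no ¬ji = inj₁ (apart⇒far (All.lookup vs (oddIndexed-⊆ _ u∈)) (All.lookup vs (oddIndexed-⊆ _ v∈))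
      (u≢v , subst₂ (λ e f → ¬ Arc e f) (sym u≡) (sym v≡) (chordless i j i≢j (¬consecutive l m pi pj ¬ij ¬ji))
           , subst₂ (λ e f → ¬ Arc e f) (sym v≡) (sym u≡) (chordless j i (i≢j ∘ sym) (¬consecutive m l pj pi ¬ji ¬ij))))
    where
    i≢j : i ≢ j
    i≢j refl = u≢v (trans u≡ (sym v≡))
    ¬consecutive : ∀ {i j : Fin (length (x ∷ xs))} l m → toℕ i ≡ 2 ℕ.* l → toℕ j ≡ 2 ℕ.* m →
      ¬ (ℕ.suc (toℕ i) ≡ length (x ∷ xs) × toℕ j ≡ 0) → ¬ (ℕ.suc (toℕ j) ≡ length (x ∷ xs) × toℕ i ≡ 0) →
      ¬ Consecutive i j
    ¬consecutive l m pi pj ¬ij ¬ji (inj₁ (inj₁ eq)) =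
      ℕ.even≢odd m l (trans (sym pj) (trans (sym eq) (cong ℕ.suc pi)))
    ¬consecutive _ _ pi pj ¬ij ¬ji (inj₁ (inj₂ w)) = ¬ij w
    ¬consecutive l m pi pj ¬ij ¬ji (inj₂ (inj₁ eq)) =
      ℕ.even≢odd l m (trans (sym pi) (trans (sym eq) (cong ℕ.suc pj)))
    ¬consecutive _ _ pi pj ¬ij ¬ji (inj₂ (inj₂ w)) = ¬ji w

  -- Distances are required only within greedy selections of size `k`, not in all of `I`: the
  -- odd-indexed vertices of an odd cycle contain a close pair, which only the selection removes.
  Spread : List (Fin n) → Set _
  Spread I = Unique I × (∀ {s} → Greedy X I s → length s ≡ k →
                         ∀ {u v} → u ∈ˡ s → v ∈ˡ s → u ≢ v → σ ≤ dmin X u v)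

  components-spread : ∀ {I Bs} → Pointwise _∈_ I Bs → All (IsStronglyConnectedComponent G) Bs →
                      AllPairs Separated Bs → Spread I
  components-spread {I} ps sccs seps =
    AllPairs.map proj₁ apart , λ g _ u∈ v∈ u≢v →
      let u∈I = greedy-⊆ g u∈; v∈I = greedy-⊆ g v∈ in
      apart⇒far (All.lookup I⊆W u∈I) (All.lookup I⊆W v∈I)
        (AllPairs-lookup (λ (a , b , c) → a ∘ sym , c , b) apart u∈I v∈I u≢v)
    where
    apart : AllPairs Apart I
    apart = separated⇒apart ps sccs seps
    vertices : ∀ {I Bs} → Pointwise _∈_ I Bs → All (IsStronglyConnectedComponent G) Bs → All (_∈ W) I
    vertices []         []         = []
    vertices (u∈ ∷ ps) (scc ∷ ss) = SCC-Vertex scc u∈ ∷ vertices ps ss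
    I⊆W : All (_∈ W) I
    I⊆W = vertices ps sccs

  pathChoice-shortest : ∀ {L} → PathChoice X W σ k L → IsShortestPath Gc L
  pathChoice-shortest (inj₁ (s , _))     = s
  pathChoice-shortest (inj₂ (_ , s , _)) = s

  -- At least 2k + 1 vertices give at least k + 1 odd-indexed ones; the surplus is the spare point
  -- on which `greedy-avoids-pair` relies.
  odd-length : ∀ {C : List (Fin n)} → 2 ℕ.* k ℕ.< length C → k ℕ.< length (oddIndexed C)
  odd-length {C} h = 2k≤1+2j⇒k≤j (ℕ.suc k) _ (ℕ.≤-trans (ℕ.≤-reflexive (ℕ.*-suc 2 k))
                       (s≤s (ℕ.≤-trans h (length≤2*oddIndexed C))))

  independent-spread : ∀ {mC M L I} → CycleChoice X W σ k mC → IsMaximumAntichain Gc M →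
                       PathChoice X W σ k L → Independent X W σ k mC M L I → Spread I
  independent-spread cyc (anti , _) path (fromAntichain _ _ ps) =
    components-spread ps (proj₁ anti) (antichain⇒separated anti)
  independent-spread cyc _ path (fromPath _ _ ps) =
    let s@((_ , vs , _) , _) = pathChoice-shortest path in
    components-spread ps (All-oddIndexed vs) (shortestPath⇒separated s)
  independent-spread cyc _ path (fromCycle {[]} (refl , _)) = contradiction (proj₁ cyc) λ ()
  independent-spread cyc _ path (fromCycle {C@(_ ∷ _)} (refl , _)) =
    unique , λ { g refl u∈ v∈ u≢v →
      AllPairs-lookup {R = Far} Far-sym
        (greedy-avoids-pair unique (cycle-odd-far cyc) g (odd-length {C} (cycle-long (proj₁ cyc)))) u∈ v∈ u≢v }
    where
    unique : Unique (oddIndexed C)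
    unique = Unique-oddIndexed C (proj₁ (proj₂ (proj₂ (proj₁ cyc))))

  extract-sound : ∀ {S} → Extract X W σ k (just S) →
                  ∣ S ∣ ≡ k × (∀ u v → u ∈ S → v ∈ S → u ≢ v → σ ≤ d u v)
  extract-sound e with Extract.select e
  ... | success {s} _ g len =
    trans (∣⋃⁅⁆∣≡length s (greedy-unique g)) len ,
    λ u v u∈ v∈ u≢v → ≤-trans
      (proj₂ (independent-spread (Extract.cycle e) (Extract.antichain e) (Extract.path e) (Extract.independent e))
        g len (∈-⋃⁅⁆⁻ s u∈) (∈-⋃⁅⁆⁻ s v∈) u≢v)
      (x⊓y≤x (d u v) (d v u))

  cycleChoice : ∃ (CycleChoice X W σ k)
  cycleChoice with Gᶠ.cycle? (Subset._∈? W) Arc? Arc⇒Vertex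
  ... | no  ¬cycle  = nothing , ¬cycle
  ... | yes (_ , C) = Product.map just id (Gᶠ.closedWalk⇒chordlessCycle (Subset._∈? W) Arc? Arc⇒Vertex Arc-irrefl
                        (Gᶠ.isCycle⇒closedWalk (Subset._∈? W) Arc? Arc⇒Vertex C))

  pathChoice : ∃ (_∈ W) → ∃ (PathChoice X W σ k)
  pathChoice (w , w∈)
    with Gcᶠ.shortestPathOfLength? isSCC? condensationArc? condensationArc⇒Vertex (2 ℕ.* k ℕ.∸ 1)
  ... | yes (L , s) = L , inj₁ s
  ... | no  ¬path   = Product.map₂ (λ l → inj₂ (¬path , l))
    (Gcᶠ.longestShortestPath isSCC? condensationArc? condensationArc⇒Vertex (component w , component-isSCC w∈))

  independent-exists : ∀ mC {M L} → All (IsStronglyConnectedComponent G) M →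
                       All (IsStronglyConnectedComponent G) L → ∃ (Independent X W σ k mC M L)
  independent-exists mC {M} {L} ms ls with useCycle? mC
    where
    useCycle? : ∀ mC → Dec (∃ (UseCycle X W σ k mC M L))
    useCycle? nothing  = no λ { (_ , () , _) }
    useCycle? (just C) = map′ (λ h → C , refl , h) (λ { (_ , refl , h) → h })
      ((2 ℕ.* length M ℕ.∸ 1 ℕ.≤? length C) ×-dec (length L ℕ.≤? length C))
  ... | yes (C , use) = _ , fromCycle use
  ... | no ¬use with length L ℕ.≤? 2 ℕ.* length M ℕ.∸ 1
  ... | yes le = Product.map₂ (fromAntichain ¬use le) (Pointwise-choice (All.map SCC-nonempty ms))
  ... | no ¬le = Product.map₂ (fromPath ¬use ¬le) (Pointwise-choice (All.map SCC-nonempty (All-oddIndexed ls)))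

  extract-exists : ∃ (_∈ W) → ∃ (Extract X W σ k)
  extract-exists w =
    let mC , cyc = cycleChoice
        M , anti = Gcᶠ.maximumAntichain isSCC? condensationArc? condensationArc⇒Vertex
        L , path = pathChoice w
        I , ind  = independent-exists mC (proj₁ (proj₁ anti)) (proj₁ (proj₂ (proj₁ (pathChoice-shortest path))))
        out , sel = select (proj₁ (independent-spread cyc anti path ind))
    in out , record { mC = mC ; M = M ; L = L ; I = I ; cycle = cyc ; antichain = anti ; path = path
                    ; independent = ind ; select = sel }
    where
    select : ∀ {I} → Unique I → ∃ (Select X W σ k I)
    select {I} u with k ℕ.≤? length I
    ... | no ¬le = nothing , failure ¬le
    ... | yes le = let s , g , len = greedy-exists u k le in _ , success le g len

  data Enough (mC : Maybe (List (Fin n))) (M L : List (Subset n)) : Set where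
    longCycle      : ∀ {C} → mC ≡ just C → 2 ℕ.* k ℕ.< length C → Enough mC M L
    largeAntichain : k ℕ.≤ length M → Enough mC M L
    longPath       : 2 ℕ.* k ℕ.≤ length L → Enough mC M L

  private
    2k≤1+⟨2j∸1⟩ : ∀ {j} → k ℕ.≤ j → 2 ℕ.* k ℕ.≤ ℕ.suc (2 ℕ.* j ℕ.∸ 1)
    2k≤1+⟨2j∸1⟩ {j} k≤j = ℕ.≤-trans (ℕ.*-monoʳ-≤ 2 k≤j) (ℕ.m≤n+m∸n (2 ℕ.* j) 1)

    2k≤m≤2j∸1⇒k≤j : ∀ {m} j → 2 ℕ.* k ℕ.≤ m → m ℕ.≤ 2 ℕ.* j ℕ.∸ 1 → k ℕ.≤ j
    2k≤m≤2j∸1⇒k≤j j h h′ = 2k≤1+2j⇒k≤j k j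
      (ℕ.≤-trans h (ℕ.≤-trans h′ (ℕ.≤-trans (ℕ.m∸n≤m _ 1) (ℕ.n≤1+n _))))

    odd-length-≥ : ∀ {A : Set a} (xs : List A) → 2 ℕ.* k ℕ.≤ ℕ.suc (length xs) → k ℕ.≤ length (oddIndexed xs)
    odd-length-≥ xs h = 2k≤1+2j⇒k≤j k _ (ℕ.≤-trans h (s≤s (length≤2*oddIndexed xs)))

  -- The tests select the branch with the largest of |C|, 2|M| - 1 and |L|, and one of these is at
  -- least 2k - 1. Every second of 2k - 1 elements gives k points, and 2|M| - 1 ≥ 2k - 1 gives |M| ≥
  -- k.
  enough⇒large : ∀ {mC M L I} → Enough mC M L → Independent X W σ k mC M L I → k ℕ.≤ length I
  enough⇒large (longCycle refl lt) (fromCycle {C} (refl , _)) =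
    odd-length-≥ C (ℕ.≤-trans (ℕ.<⇒≤ lt) (ℕ.n≤1+n _))
  enough⇒large (largeAntichain le) (fromCycle {C} (_ , h , _)) = odd-length-≥ C (ℕ.≤-trans (2k≤1+⟨2j∸1⟩ le) (s≤s h))
  enough⇒large (longPath le) (fromCycle {C} (_ , _ , h)) =
    odd-length-≥ C (ℕ.≤-trans le (ℕ.≤-trans h (ℕ.n≤1+n _)))
  enough⇒large {M = M} E (fromAntichain ¬use h ps) = subst (k ℕ.≤_) (sym (Pointwise.Pointwise-length ps)) (size E)
    where
    size : Enough _ M _ → k ℕ.≤ length M
    size (largeAntichain le)     = le
    size (longPath le)           = 2k≤m≤2j∸1⇒k≤j (length M) le h
    -- A cycle as long as 2|M| - 1 would also be as long as `L`, and the cycle branch would have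
    -- been taken.
    size (longCycle {C} refl lt) = 2k≤m≤2j∸1⇒k≤j (length M) (ℕ.<⇒≤ lt)
      (ℕ.<⇒≤ (ℕ.≰⇒> λ le → ¬use (C , refl , le , ℕ.≤-trans h le)))
  enough⇒large {M = M} {L} E (fromPath ¬use h ps) =
    subst (k ℕ.≤_) (sym (Pointwise.Pointwise-length ps)) (odd-length-≥ L (ℕ.≤-trans (size E) (ℕ.n≤1+n _)))
    where
    size : Enough _ M L → 2 ℕ.* k ℕ.≤ length L
    size (largeAntichain le)     = ℕ.≤-trans (2k≤1+⟨2j∸1⟩ le) (ℕ.≰⇒> h)
    size (longPath le)           = le
    size (longCycle {C} refl lt) = ℕ.<⇒≤ (ℕ.<-≤-trans lt
      (ℕ.<⇒≤ (ℕ.≰⇒> λ le → ¬use (C , refl , ℕ.≤-trans (ℕ.<⇒≤ (ℕ.≰⇒> h)) le , le))))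

  module Acyclic (¬cycle : ¬ ∃ (IsCycle G)) where

    SCC-singleton : ∀ {B u v} → IsStronglyConnectedComponent G B → u ∈ B → v ∈ B → u ≡ v
    SCC-singleton scc u∈ v∈ with SCC-reaches scc u∈ v∈
    ... | ε       = refl
    ... | arc ◅ s = contradiction
      (Gᶠ.arc∧reaches⇒cycle (Subset._∈? W) Arc? Arc⇒Vertex Arc-irrefl arc (s ◅◅ SCC-reaches scc v∈ u∈)) ¬cycle

    -- Consecutive arcs of the condensation may enter and leave a component at different points, and
    -- the distance between these is not controlled by one arc. Without cycles the points coincide,
    -- and the triangle inequality adds up the arcs.
    condensedWalk-≤ : ∀ B Bs {D u v} → Linked (Digraph.Arc Gc) (B ∷ Bs) → last (B ∷ Bs) ≡ just D →
                      IsStronglyConnectedComponent G B → u ∈ B → v ∈ D → d u v ≤ length Bs · σ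
    condensedWalk-≤ B []       {u = u} _ refl scc u∈ v∈ rewrite SCC-singleton scc v∈ u∈ = ≤-reflexive (d-self u)
    condensedWalk-≤ B (_ ∷ Bs) {u = u} {v} ((_ , scc′ , _ , i , j , i∈ , j∈ , _ , _ , _ , lt) ∷ ls) eq scc u∈ v∈
      rewrite SCC-singleton scc u∈ i∈ =
      ≤-trans (triangle i v j) (+-mono-≤ (proj₁ lt) (condensedWalk-≤ _ Bs ls eq scc′ j∈ v∈))

    -- Only the existence of this path matters: it excludes the fallback in `PathChoice`, so the `L`
    -- of the run, whatever its ends, has 2k vertices.
    shortestPath-exists : ∀ {x y} → x ∈ W → y ∈ W → R ≤ d x y → Reaches G x y →
                          ∃ λ P → IsShortestPath Gc P × numArcs Gc P ≡ 2 ℕ.* k ℕ.∸ 1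
    shortestPath-exists {x} {y} x∈ y∈ R≤d s =
      let Bs , short@((_ , _ , ls , _) , _) , eq =
            Gcᶠ.reaches⇒shortestPath isSCC? condensationArc? condensationArc⇒Vertex
              (component-isSCC x∈) (condensation-reaches⁺ x∈ s)
          m = 2 ℕ.* k ℕ.∸ 1
          2k≤ = R≤m·σ⇒2k≤m (length Bs)
            (≤-trans R≤d (condensedWalk-≤ _ Bs ls eq (component-isSCC x∈) (∈-component x∈) (∈-component y∈)))
      in component x ∷ take m Bs ,
         Gcᶠ.prefix-shortest isSCC? condensationArc? condensationArc⇒Vertex (component x) (take m Bs) (drop m Bs)
           (subst (λ e → IsShortestPath Gc (component x ∷ e)) (sym (take++drop≡id m Bs)) short) ,
         trans (length-take m Bs) (ℕ.m≤n⇒m⊓n≡m (ℕ.≤-trans (ℕ.m∸n≤m _ 1) 2k≤))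

  -- Clustering alone bounds only the larger of the two distances. Both are required here, so that
  -- reachability in either direction has to span `R`.
  FarCentres : Fin n → Fin n → Set _
  FarCentres x y = x ∈ W × y ∈ W × R ≤ d x y × R ≤ d y x

  enough : ∀ {mC M L cs} → CycleChoice X W σ k mC → IsMaximumAntichain Gc M → PathChoice X W σ k L →
           All (_∈ W) cs → AllPairs FarCentres cs → length cs ≡ k → Enough mC M L
  enough {just C}            cyc _ _ _ _ _ = longCycle refl (cycle-long (proj₁ cyc))
  enough {nothing} {M} {L} {cs} ¬cycle (_ , largest) path cs⊆W far refl =
    Sum.[ (λ pairs → largeAntichain (subst (ℕ._≤ length M) (length-map component cs)
            (largest (map component cs) (All.map⁺ (All.map component-isSCC cs⊆W) , AllPairs.map⁺ pairs))))
        , (λ (x , y , x∈ , y∈ , R≤d , s) → longPath (path-length path (shortestPath-exists x∈ y∈ R≤d s)))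
        ] (AllPairs-⊎ unreachable far)
    where
    open Acyclic ¬cycle

    ReachableFar : Set _
    ReachableFar = ∃₂ λ x y → x ∈ W × y ∈ W × R ≤ d x y × Reaches G x y

    unreachable : ∀ {x y} → FarCentres x y →
      (¬ Reaches Gc (component x) (component y) × ¬ Reaches Gc (component y) (component x)) ⊎ ReachableFar
    unreachable {x} {y} (x∈ , y∈ , xy , yx) with Gᶠ.reaches? Arc? x y | Gᶠ.reaches? Arc? y x
    ... | yes s | _     = inj₂ (x , y , x∈ , y∈ , xy , s)
    ... | no _  | yes s = inj₂ (y , x , y∈ , x∈ , yx , s)
    ... | no ¬s | no ¬t = inj₁
      ( ¬s ∘ condensation-reaches⁻ (component-isSCC x∈) (∈-component x∈) (∈-component y∈)
      , ¬t ∘ condensation-reaches⁻ (component-isSCC y∈) (∈-component y∈) (∈-component x∈) )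

    path-length : ∀ {L} → PathChoice X W σ k L →
                  (∃ λ P → IsShortestPath Gc P × numArcs Gc P ≡ 2 ℕ.* k ℕ.∸ 1) → 2 ℕ.* k ℕ.≤ length L
    path-length (inj₂ (¬path , _)) path = contradiction path ¬path
    path-length {[]}    (inj₁ (((ne , _) , _) , _)) _ = contradiction refl ne
    path-length {_ ∷ L} (inj₁ (_ , len))            _ =
      ℕ.≤-trans (ℕ.m≤n+m∸n (2 ℕ.* k) 1) (ℕ.≤-reflexive (cong ℕ.suc (sym len)))

  extract-succeeds : ∀ {out cs} → All (_∈ W) cs → AllPairs FarCentres cs → length cs ≡ k →
                     Extract X W σ k out → ∃ λ S → out ≡ just S
  extract-succeeds cs⊆W far len e with Extract.select e
  ... | success _ _ _ = _ , refl
  ... | failure ¬le = contradiction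
    (enough⇒large (enough (Extract.cycle e) (Extract.antichain e) (Extract.path e) cs⊆W far len)
                  (Extract.independent e)) ¬le

-- Thresholds, existence of a run and the approximation ratio.

module Approximation {c ℓ₁ ℓ₂} {F : OrderedField c ℓ₁ ℓ₂} {n : ℕ} (X : AsymmetricPseudometric F n)
                     (k : ℕ) (2≤k : 2 ℕ.≤ k) where
  open OrderedField F renaming (refl to ≈-refl; sym to ≈-sym; trans to ≈-trans) hiding (zero)
  open OrderedFieldProperties F
  open AsymmetricPseudometric X
  open Metric X
  open Extrema totalOrder using (argmin; argmin-sel; f[argmin]≤f[xs])
  open SetoidMembership setoid using () renaming (_∈_ to _∈ₛ_)

  private instance
    2k≢0 : ℕ.NonZero (2 ℕ.* k)
    2k≢0 = ℕ.m*n≢0 2 k {{_}} {{ℕ.>-nonZero (ℕ.<⇒≤ 2≤k)}}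

  threshold-positive : ∀ {R} → IsThreshold X R → 0# < R
  threshold-positive (_ , _ , _ , 0<d , eq) = <-≤-trans 0<d (≤-reflexive eq)

  private
    dist : Fin n × Fin n → Carrier
    dist (i , j) = d i j

    positive? : Decidable (λ ((i , j) : Fin n × Fin n) → i ≢ j × 0# < d i j)
    positive? (i , j) = ¬? (i Fin.≟ j) ×-dec 0# <? d i j

    distances : List Carrier
    distances = map dist (filter positive? (cartesianProduct (allFin n) (allFin n)))

  thresholdList : List Carrier
  thresholdList = deduplicate _≈?_ distances

  thresholdList-complete : ∀ R → R ∈ₛ thresholdList ⇔ IsThreshold X R
  thresholdList-complete R = mk⇔ to from
    where
    to : R ∈ₛ thresholdList → IsThreshold X R
    to R∈ with y , y∈ , R≈y ← find R∈
          with (i , j) , e∈ , refl ← ∈-map⁻ dist (∈-deduplicate⁻ _≈?_ distances y∈)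
          with _ , i≢j , 0<d ← ∈-filter⁻ positive? {xs = cartesianProduct (allFin n) (allFin n)} e∈
          = i , j , i≢j , 0<d , ≈-sym R≈y
    from : IsThreshold X R → R ∈ₛ thresholdList
    from (i , j , i≢j , 0<d , eq) = Setoid∈.∈-deduplicate⁺ setoid _≈?_ (λ z≈y x≈y → ≈-trans x≈y (≈-sym z≈y))
      (Any.map (λ { refl → ≈-sym eq }) (∈-map⁺ dist (∈-filter⁺ positive?
        (∈-cartesianProduct⁺ (∈-allFin i) (∈-allFin j)) (i≢j , 0<d))))

  iteration-sound : ∀ {R S} → 0# < R → Iteration X k R (just S) →
                    ∣ S ∣ ≡ k × (∀ u v → u ∈ S → v ∈ S → u ≢ v → R / fromℕ (2 ℕ.* k) ≤ d u v)
  iteration-sound {R} 0<R (U′ , cl , ex) = Extraction.extract-sound X U′ R k 0<R (cluster-separated cl) ex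

  -- The given point ensures that the clustering returns a centre; over an empty vertex set the
  -- condensation would have no path to serve as `L`.
  iteration-exists : Fin n → ∀ {R} → 0# < R → ∃ (Iteration X k R)
  iteration-exists u {R} 0<R =
    let U′ , cl    = cluster-exists 0<R
        x , x∈ , _ = cluster-covers cl (Subset.∈⊤ {x = u})
        out , ex   = Extraction.extract-exists X U′ R k 0<R (cluster-separated cl) (x , x∈)
    in out , U′ , cl , ex

  best-exists : ∀ outs → (∀ S → just S ∈ˡ outs → ∃ (IsDiv X S)) → ∃ (Best X outs)
  best-exists outs divs with search outs divs
    where
    -- One value `r` of the diversity is carried along, as `IsDiv` fixes it only up to `≈`;
    -- `div-greatest` transfers the comparison to any other value.
    Search : List (Maybe (Subset n)) → Set _
    Search outs = All (_≡ nothing) outs ⊎ ∃₂ λ S r → just S ∈ˡ outs × IsDiv X S r ×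
                  (∀ T t → just T ∈ˡ outs → IsDiv X T t → t ≤ r)
    search : ∀ outs → (∀ S → just S ∈ˡ outs → ∃ (IsDiv X S)) → Search outs
    search []             divs = inj₁ []
    search (nothing ∷ os) divs with search os (λ S → divs S ∘ there)
    ... | inj₁ all = inj₁ (refl ∷ all)
    ... | inj₂ (S , r , S∈ , dS , max) = inj₂ (S , r , there S∈ , dS , λ { T t (there T∈) → max T t T∈ })
    search (just S ∷ os)  divs with divs S (here refl) | search os (λ S → divs S ∘ there)
    ... | r , dS | inj₁ all = inj₂ (S , r , here refl , dS , λ where
          T t (here refl) dT → div-greatest dS (proj₂ dT)
          T t (there T∈)  dT → contradiction (All.lookup all T∈) λ ())
    ... | r , dS | inj₂ (S′ , r′ , S′∈ , dS′ , max) with ≤-total r r′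
    ...   | inj₁ r≤r′ = inj₂ (S′ , r′ , there S′∈ , dS′ , λ where
            T t (here refl) dT → ≤-trans (div-greatest dS (proj₂ dT)) r≤r′
            T t (there T∈)  dT → max T t T∈ dT)
    ...   | inj₂ r′≤r = inj₂ (S , r , here refl , dS , λ where
            T t (here refl) dT → div-greatest dS (proj₂ dT)
            T t (there T∈)  dT → ≤-trans (max T t T∈ dT) r′≤r)
  ... | inj₁ all = nothing , lift all
  ... | inj₂ (S , r , S∈ , dS , max) =
        just S , S∈ , λ T s t T∈ dS′ dT → ≤-trans (max T t T∈ dT) (div-greatest dS′ (proj₂ dS))

  private
    iteration-div : ∀ {R S} → 0# < R → Iteration X k R (just S) → ∃ (IsDiv X S)
    iteration-div 0<R it = div-exists (subst (2 ℕ.≤_) (sym (proj₁ (iteration-sound 0<R it))) 2≤k)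

    outs-iteration : ∀ {ts outs} → (∀ R → R ∈ₛ ts ⇔ IsThreshold X R) → Pointwise (Iteration X k) ts outs →
                     ∀ {out} → out ∈ˡ outs → ∃ λ R → 0# < R × Iteration X k R out
    outs-iteration complete its out∈ =
      let R , R∈ , it = Pointwise-∈ˡ (Pointwise.symmetric id its) out∈
      in R , threshold-positive (Equivalence.to (complete R) (Any.map (λ { refl → ≈-refl }) R∈)) , it

  bac-exists : Fin n → ∃ (BAC X k)
  bac-exists u =
    let outs , its = Pointwise-choice {R = λ out R → Iteration X k R out} (All.tabulate λ {R} R∈ → iteration-exists u
                       (threshold-positive (Equivalence.to (thresholdList-complete R) (Any.map (λ { refl → ≈-refl }) R∈))))
        its′ = Pointwise.symmetric id its
        out , best = best-exists outs λ S S∈ →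
          let R , 0<R , it = outs-iteration thresholdList-complete its′ S∈ in iteration-div 0<R it
    in out , record
      { thresholds = thresholdList
      ; distinct   = DecSetoidUnique.deduplicate-! (DecTotalOrder.Eq.decSetoid decTotalOrder) distances
      ; complete   = thresholdList-complete
      ; outs       = outs
      ; iterations = its′
      ; best       = best
      }

  module _ {R* : Carrier} (optimal : IsOptimalValue X k R*) (0<R* : 0# < R*) where

    private
      O : Subset n
      O = proj₁ (proj₁ optimal)

      ∣O∣≡k : ∣ O ∣ ≡ k
      ∣O∣≡k = proj₁ (proj₂ (proj₁ optimal))

      O-far : ∀ u v → u ∈ O → v ∈ O → u ≢ v → R* ≤ d u v
      O-far = proj₂ (proj₂ (proj₂ (proj₁ optimal)))

    -- `R*` is attained as a distance, so some threshold satisfies the bound of `LeastAbove`.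
    R*-threshold : IsThreshold X R*
    R*-threshold = let u , v , _ , _ , u≢v , eq = proj₁ (proj₂ (proj₂ (proj₁ optimal)))
                   in u , v , u≢v , <-≤-trans 0<R* (≤-reflexive (≈-sym eq)) , eq

    -- The bound is R ≥ `R*` / 3 without the division. Minimality means that no threshold lies in
    -- the gap between `R*` / 3 and `R`, so clustering with either radius would give the same
    -- clusters.
    LeastAbove : Carrier → Set _
    LeastAbove R = R* ≤ 3 · R × (∀ R′ → IsThreshold X R′ → R* ≤ 3 · R′ → R ≤ R′)

    leastThreshold : ∀ {ts} → (∀ R → R ∈ₛ ts ⇔ IsThreshold X R) → ∃ λ R → R ∈ˡ ts × LeastAbove R
    leastThreshold {ts} complete with R₀ , R₀∈ , R*≈R₀ ← find (Equivalence.from (complete R*) R*-threshold)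
      = R , proj₁ R-ok , proj₂ R-ok , least
      where
      above? : Decidable (λ R → R* ≤ 3 · R)
      above? R = R* ≤? 3 · R
      R = argmin id R₀ (filter above? ts)
      R₀-above : R* ≤ 3 · R₀
      R₀-above = ≤-trans (≤-reflexive (≈-trans R*≈R₀ (≈-sym (+-identityʳ R₀))))
        (+-mono-≤ ≤-refl (·-nonNegative 2 (≤-trans (proj₁ 0<R*) (≤-reflexive R*≈R₀))))
      R-ok : R ∈ˡ ts × R* ≤ 3 · R
      R-ok with argmin-sel id R₀ (filter above? ts)
      ... | inj₁ eq = subst (λ R → R ∈ˡ ts × R* ≤ 3 · R) (sym eq) (R₀∈ , R₀-above)
      ... | inj₂ R∈ = ∈-filter⁻ above? R∈
      least : ∀ R′ → IsThreshold X R′ → R* ≤ 3 · R′ → R ≤ R′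
      least R′ th h with y , y∈ , R′≈y ← find (Equivalence.from (complete R′) th) =
        ≤-trans (All.lookup (f[argmin]≤f[xs] {f = id} R₀ (filter above? ts))
                  (∈-filter⁺ above? y∈ (≤-trans h (·-monoʳ-≤ 3 (≤-reflexive R′≈y)))))
                (≤-reflexive (≈-sym R′≈y))

    -- A distance of at least a third of `R*` is positive, hence itself a threshold, and minimality
    -- applies to it.
    leastAbove⇒≤ : ∀ {R} → LeastAbove R → ∀ {i j} → R* ≤ 3 · d i j → R ≤ d i j
    leastAbove⇒≤ (_ , least) {i} {j} h = least (d i j) (i , j , i≢j , 0<d , ≈-refl) h
      where
      0<d : 0# < d i j
      0<d = ≰⇒> λ d≤0 → <⇒≱ 0<R* (≤-trans h (≤-trans (·-monoʳ-≤ 3 d≤0) (≤-reflexive (·-zeroʳ 3))))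
      i≢j : i ≢ j
      i≢j refl = <⇒≱ 0<d (≤-reflexive (d-self i))

    -- A distance below R is below R* / 3, so the centres of two optimal
    -- points cannot be closer than R to each other.
    centres-far : ∀ {R} → LeastAbove R → ∀ {x y o o′} → dmax X x o < R → dmax X y o′ < R →
                  R* ≤ d o o′ → R ≤ d x y
    centres-far lst {x} {y} {o} {o′} xo yo′ h
      with ≤-sum₃⇒≤-3· (≤-trans h (≤-trans (triangle o o′ x) (+-mono-≤ ≤-refl (triangle x o′ y))))
    ... | inj₁ ox          = contradiction (leastAbove⇒≤ lst ox) (<⇒≱ (proj₂ (dmax<⇒< xo)))
    ... | inj₂ (inj₁ xy)   = leastAbove⇒≤ lst xy
    ... | inj₂ (inj₂ yo)   = contradiction (leastAbove⇒≤ lst yo) (<⇒≱ (proj₁ (dmax<⇒< yo′)))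

    iteration-succeeds : ∀ {R out} → 0# < R → LeastAbove R → Iteration X k R out → ∃ λ S → out ≡ just S
    iteration-succeeds {R} 0<R lst (U′ , cl , ex) =
      -- One centre for each optimal point. Two of these points cannot share a centre `x`, as `far`
      -- would then give `R ≤ d x x`.
      let cs , centres = Pointwise-choice {R = λ x o → x ∈ U′ × dmax X x o < R}
                           (All.tabulate {xs = elements O} λ _ → cluster-covers cl Subset.∈⊤)
          far = AllPairs-Pointwise
            (λ { ((x∈ , xo) , o∈) ((y∈ , yo′) , o′∈) o≢o′ →
                 x∈ , y∈ , centres-far lst xo yo′ (O-far _ _ o∈ o′∈ o≢o′) ,
                 centres-far lst yo′ xo (O-far _ _ o′∈ o∈ (o≢o′ ∘ sym)) })
            (Pointwise-All centres (elements-∈ O)) (elements-unique O)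
      in Extraction.extract-succeeds X U′ R k 0<R (cluster-separated cl)
           (All.tabulate λ x∈ → proj₁ (proj₂ (proj₂ (Pointwise-∈ˡ centres x∈)))) far
           (trans (Pointwise.Pointwise-length centres) (trans (length-elements O) ∣O∣≡k)) ex

    -- The set returned may stem from another threshold, possibly with a much smaller σ. Its own
    -- iteration supplies the cardinality and the existence of the diversity; the ratio comes from
    -- comparison with the set `T` found for the least threshold.
    bac-sound : ∀ out → BAC X k out → ∃ λ S → out ≡ just S × ∣ S ∣ ≡ k ×
                (∃ λ r → IsDiv X S r × R* / fromℕ (6 ℕ.* k) ≤ r)
    bac-sound out run
      with R , R∈ , lst ← leastThreshold (BAC.complete run)
      with out′ , out′∈ , it ← Pointwise-∈ˡ (BAC.iterations run) R∈
      with 0<R ← threshold-positive (Equivalence.to (BAC.complete run R) (Any.map (λ { refl → ≈-refl }) R∈))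
      with T , refl ← iteration-succeeds 0<R lst it
      with out | BAC.best run
    ... | nothing | lift all = contradiction (All.lookup all out′∈) λ ()
    ... | just S  | S∈ , max =
      let R′ , 0<R′ , it′ = outs-iteration (BAC.complete run) (BAC.iterations run) S∈
          s , dS = iteration-div 0<R′ it′
          t , dT = iteration-div 0<R it
      in S , refl , proj₁ (iteration-sound 0<R′ it′) , s , dS ,
         ≤-trans (ratio (proj₁ lst)) (≤-trans (div-greatest dT (proj₂ (iteration-sound 0<R it))) (max T s t out′∈ dS dT))
      where
      ratio : R* ≤ 3 · R → R* / fromℕ (6 ℕ.* k) ≤ R / fromℕ (2 ℕ.* k)
      ratio h = subst (λ m → R* / fromℕ m ≤ R / fromℕ (2 ℕ.* k)) (sym (ℕ.*-assoc 3 2 k))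
        (/-mono-≤-· 3 (2 ℕ.* k) {{2k≢0}} {{ℕ.m*n≢0 3 (2 ℕ.* k)}} h)

theorem5p5 : ∀ {c ℓ₁ ℓ₂} (F : OrderedField c ℓ₁ ℓ₂) → let open OrderedField F in
    (n k : ℕ) (X : AsymmetricPseudometric F n) → 2 ℕ.≤ k → k ℕ.≤ n →
    (R* : Carrier) → IsOptimalValue X k R* → 0# < R* →
    (∃ λ out → BAC X k out) ×
    (∀ out → BAC X k out →
    ∃ λ S → out ≡ just S × ∣ S ∣ ≡ k ×
    (∃ λ r → IsDiv X S r × R* / fromℕ (6 ℕ.* k) ≤ r))
theorem5p5 F n k X 2≤k k≤n R* optimal 0<R* =
  bac-exists (Fin.fromℕ< (ℕ.≤-trans 2≤k k≤n)) , bac-sound optimal 0<R*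
  where open Approximation X k 2≤k
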